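{- Let $p_4(n)$ denote the number of partitions of $n$ into parts congruent to $\pm 2, \pm 3, \pm 7, \pm 8,\pm 12,\pm 13 \pmod{30}$, where the parts congruent to $\pm 2, \pm 3,\pm 8, \pm 12 \pmod{30}$ have two colors. Let $p_5(n)$ denote the number of partitions of $n$ into parts congruent to $\pm 1, \pm 4,\pm 6, \pm 9, \pm 11,\pm 14 \pmod{30}$, where the parts congruent to $\pm 4, \pm 6, \pm 9, \pm 14 \pmod{30}$ have two colors. Let $p_6(n)$ denote the number of partitions of $n$ into parts congruent to $\pm 2, \pm 3,\pm 4, \pm 5,\pm 6, \pm8,\pm 9, \pm 12, \pm 14 \pmod{30}$, where the parts congruent to $\pm 5 \pmod{30}$ have two colors. Then for each positive integer $n>1$, \[ p_4(n)-p_5(n-2)=p_6(n). \]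
   Context: A partition in which parts from certain residue classes "have two colors" means each such part size may appear in two distinguishable copies (colors), so the generating function for parts $\equiv r \pmod{s}$ with $k$ colors is $\prod_{m\ge0}(1-q^{sm+r})^{ -k}$. Here $\pm r \pmod{30}$ means the classes $r$ and $30-r$ modulo $30$; parts are positive integers. By convention $p_i(0)=1$. -}

module Defs where

open import Data.Nat using (ℕ; zero; suc; _*_; _∸_; _≤?_; _%_; _≡ᵇ_)
open import Data.Bool using (Bool; true; false; if_then_else_; _∨_)
open import Data.Nat.ListAction using (sum)
open import Data.List using (List; []; _∷_; map; upTo; concatMap; replicate)
open import Data.Bool.ListAction using (any)
open import Relation.Nullary.Decidable using (does)

-- Number of partitions of n into parts drawn from a list of "kinds":
-- each entry k of the list is a distinguishable kind of part of size k
-- (a part size appearing c times in the list has c colors), and each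
-- kind may be used any number of times.
-- countKinds (k ∷ ks) n = Σ_{j ≥ 0, j*k ≤ n} countKinds ks (n - j*k).
countKinds : List ℕ → ℕ → ℕ
countKinds [] zero = 1
countKinds [] (suc _) = 0
countKinds (k ∷ ks) n =
  sum (map (λ j → if does (j * k ≤? n) then countKinds ks (n ∸ j * k) else 0)
           (upTo (suc n)))

-- Colored partition function: colors s = number of colors of parts of size s
-- (0 means size s is not allowed).  Only positive part sizes 1..n are used,
-- which are all the part sizes that can occur in a partition of n.
coloredPartitions : (ℕ → ℕ) → ℕ → ℕ
coloredPartitions colors n =
  countKinds (concatMap (λ s → replicate (colors s) s) (map suc (upTo n))) n

inPM : List ℕ → ℕ → Bool
inPM rs s = any (λ r → (s % 30 ≡ᵇ r) ∨ (s % 30 ≡ᵇ (30 ∸ r))) rs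

colors₄ : ℕ → ℕ
colors₄ s = if inPM (2 ∷ 3 ∷ 8 ∷ 12 ∷ []) s then 2
            else if inPM (7 ∷ 13 ∷ []) s then 1 else 0

colors₅ : ℕ → ℕ
colors₅ s = if inPM (4 ∷ 6 ∷ 9 ∷ 14 ∷ []) s then 2
            else if inPM (1 ∷ 11 ∷ []) s then 1 else 0

colors₆ : ℕ → ℕ
colors₆ s = if inPM (5 ∷ []) s then 2
            else if inPM (2 ∷ 3 ∷ 4 ∷ 6 ∷ 8 ∷ 9 ∷ 12 ∷ 14 ∷ []) s then 1 else 0

p₄ p₅ p₆ : ℕ → ℕ
p₄ = coloredPartitions colors₄
p₅ = coloredPartitions colors₅
p₆ = coloredPartitions colors₆

{-# OPTIONS --safe #-}
-- Write [a] = (q^a, q^(30−a); q^30)_∞, and let θ(z) be the theta product of z to the base p = q^10,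
-- with θ_a = θ(q^a). Since (1 − x)(1 − ωx)(1 − ω²x) = 1 − x³ for a primitive cube root of unity ω, the
-- product Ω_a = θ(ωq^a) θ(ω²q^a) satisfies Ω_a θ_a = [3a]. After clearing the denominators of the
-- generating functions the claim becomes the three-term relation
--   θ₄² Ω₃ = q² θ₂² Ω₁ + θ₂ θ₄ Ω₅.
-- By Jacobi's triple product a product of two thetas is a double series over (m , n). Summing it along
-- the diagonals m + n separates the variables, so that θ(xz) θ(x/z), up to elementary factors, is a
-- 2 × 2 determinant r(x) s(z) − s(x) r(z). The three-term relation is then the Plücker relation for
-- the points q, q³, q⁵ and ω. All of this takes place in ℤ[ω][[q]] modulo q^(n+1), where a power of
-- every series without constant term vanishes and all sums and products are finite.
module Submission where

open import Defs
open import Algebra.Bundles using (CommutativeRing; RawRing)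
open import Data.Bool.Base using (if_then_else_; _∨_)
open import Data.Bool.ListAction using (any)
open import Data.Empty using (⊥)
open import Data.Integer.Base as ℤ using (ℤ; +_; -[1+_]; _⊖_)
import Data.Integer.Properties as ℤ
import Data.Integer.Solver
import Data.Integer.Tactic.RingSolver as ℤ-Solver
open import Data.List.Base using (List; []; _∷_; [_]; _++_; map; foldr; upTo; applyUpTo;
  cartesianProduct; concatMap; replicate)
open import Data.List.Membership.Propositional using (_∈_; _∉_)
open import Data.List.Membership.Propositional.Properties
open import Data.List.Properties using (map-applyUpTo; map-cong; upTo-∷ʳ; concatMap-++; map-++; ++-identityʳ)
open import Data.List.Relation.Binary.Permutation.Propositional as ↭ using (_↭_; ↭⇒↭ₛ)
import Data.List.Relation.Binary.Permutation.Propositional.Properties as ↭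
import Data.List.Relation.Binary.Permutation.Setoid.Properties as ↭ₛ
open import Data.List.Relation.Binary.Subset.Propositional using (_⊆_)
open import Data.List.Relation.Unary.All as All using (All; []; _∷_)
import Data.List.Relation.Unary.All.Properties as All
open import Data.List.Relation.Unary.AllPairs using ([]; _∷_)
open import Data.List.Relation.Unary.Any using (here; there)
open import Data.List.Relation.Unary.Unique.Propositional using (Unique)
import Data.List.Relation.Unary.Unique.Propositional.Properties as Unique
open import Data.Maybe.Base using (Maybe; just; nothing)
open import Data.Nat.Base as ℕ using (ℕ; zero; suc; _≤_; _<_; _∸_; _%_; _≡ᵇ_; z≤n; s≤s)
open import Data.Nat.DivMod using ([m+kn]%n≡m%n)
open import Data.Nat.ListAction using (sum)
import Data.Nat.Properties as ℕ
import Data.Nat.Tactic.RingSolver as ℕ-Solver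
open import Data.Product.Base using (_×_; _,_; ∃-syntax; proj₁)
open import Data.Product.Properties using (,-injective; ≡-dec)
open import Data.Sum.Base using (_⊎_; inj₁; inj₂; [_,_]′)
open import Function.Base using (_∘_; id)
open import Relation.Binary.PropositionalEquality as ≡ using (_≡_; _≢_)
open import Relation.Nullary.Decidable using (does; dec-true; dec-false; yes; no)
open import Relation.Nullary.Negation using (contradiction)

-- The modulus 30 enters through Ω_a = [3a]/θ_a. Splitting the base-10 thetas into residues modulo
-- 30 gives θ₁ = [1][9][11], θ₂ = [2][8][12], θ₃ = [3][7][13], θ₄ = [4][6][14] and θ₅ = [5]²[15],
-- hence Ω₁ = [3]/θ₁, Ω₃ = [9]/θ₃ and Ω₅ = 1/[5]². Multiplied by θ₁ θ₃ [5]², the three-term relation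
-- acquires the products θ₄² θ₁ [9] and θ₂² θ₃ [3], the reciprocals of the generating functions of
-- p₅ and p₄; the remaining term θ₁ θ₂ θ₃ θ₄ divides their product with quotient θ₂ θ₄ [3][9], which
-- together with [5]² is the reciprocal of the generating function of p₆. This explains the colors:
-- the doubled classes 2, 8, 12 and 4, 6, 14 come from the squares θ₂² and θ₄², the doubled 3 and 9
-- from the numerators of Ω₁ and Ω₃, and the doubled 5 from Ω₅.

-- Ring solver with integer coefficients over an arbitrary commutative ring

-- The coefficient (a , b) stands for the integer a − b, so that no zero test in R is needed.
-- Reducing keeps coefficients canonical, since the solver compares normal forms syntactically.
module IntegerCoefficients {c ℓ} (R : CommutativeRing c ℓ) where
  open CommutativeRing R hiding (zero)
  open import Algebra.Properties.Semiring.Mult.TCOptimised semiring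
    renaming (_×_ to _·_)
  open import Algebra.Properties.Ring ring
    using (-‿distribˡ-*; -‿distribʳ-*; -‿involutive)
  open import Algebra.Properties.AbelianGroup +-abelianGroup using (⁻¹-∙-comm; ε⁻¹≈ε)
  open import Algebra.Properties.CommutativeSemigroup
    (CommutativeRing.+-commutativeSemigroup R) using (interchange)
  open import Relation.Binary.Reasoning.Setoid setoid
  open import Algebra.Solver.Ring.AlmostCommutativeRing

  private
    reduce : ℕ → ℕ → ℕ × ℕ
    reduce (suc a) (suc b) = reduce a b
    reduce a       b       = a , b

    differences : RawRing _ _
    differences = record
      { Carrier = ℕ × ℕ
      ; _≈_     = _≡_
      ; _+_     = λ (a , b) (c , d) → reduce (a ℕ.+ c) (b ℕ.+ d)
      ; _*_     = λ (a , b) (c , d) → reduce (a ℕ.* c ℕ.+ b ℕ.* d) (a ℕ.* d ℕ.+ b ℕ.* c)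
      ; -_      = λ (a , b) → b , a
      ; 0#      = 0 , 0
      ; 1#      = 1 , 0
      }

    -- Without a subtrahend in the case `zero`, the coefficients (0 , 0) and (1 , 0) evaluate to
    -- `0#` and `1#` definitionally, so solver equations match the goals as they are written.
    ⟦_⟧ : ℕ × ℕ → Carrier
    ⟦ a , zero ⟧  = a · 1#
    ⟦ a , suc b ⟧ = a · 1# + - (suc b · 1#)

    ⟦⟧-difference : ∀ a b → ⟦ a , b ⟧ ≈ a · 1# + - (b · 1#)
    ⟦⟧-difference a zero    = sym (trans (+-congˡ ε⁻¹≈ε) (+-identityʳ _))
    ⟦⟧-difference a (suc b) = refl

    +-difference : ∀ a b c d → (a + c) + - (b + d) ≈ (a + - b) + (c + - d)
    +-difference a b c d = trans (+-congˡ (sym (⁻¹-∙-comm b d))) (interchange a c (- b) (- d))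

    ⟦reduce⟧ : ∀ a b → ⟦ reduce a b ⟧ ≈ a · 1# + - (b · 1#)
    ⟦reduce⟧ zero    b       = ⟦⟧-difference zero b
    ⟦reduce⟧ (suc a) zero    = ⟦⟧-difference (suc a) zero
    ⟦reduce⟧ (suc a) (suc b) = begin
      ⟦ reduce a b ⟧                          ≈⟨ ⟦reduce⟧ a b ⟩
      a · 1# + - (b · 1#)                     ≈⟨ +-identityˡ _ ⟨
      0# + (a · 1# + - (b · 1#))              ≈⟨ +-congʳ (-‿inverseʳ 1#) ⟨
      (1# + - 1#) + (a · 1# + - (b · 1#))     ≈⟨ +-difference 1# 1# (a · 1#) (b · 1#) ⟨
      (1# + a · 1#) + - (1# + b · 1#)         ≈⟨ +-cong (×-homo-+ 1# 1 a) (-‿cong (×-homo-+ 1# 1 b)) ⟨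
      suc a · 1# + - (suc b · 1#)             ∎

    *-difference : ∀ a b c d →
      (a * c + b * d) + - (a * d + b * c) ≈ (a + - b) * (c + - d)
    *-difference a b c d = begin
      (a * c + b * d) + - (a * d + b * c)
        ≈⟨ +-difference (a * c) (a * d) (b * d) (b * c) ⟩
      (a * c + - (a * d)) + (b * d + - (b * c))
        ≈⟨ +-cong (+-congˡ (-‿distribʳ-* a d)) (+-comm _ _) ⟩
      (a * c + a * - d) + (- (b * c) + b * d)
        ≈⟨ +-cong (sym (distribˡ a c (- d)))
                  (+-cong (-‿distribˡ-* b c) (trans (sym (-‿involutive _))
                    (trans (-‿cong (-‿distribˡ-* b d)) (-‿distribʳ-* (- b) d)))) ⟩
      a * (c + - d) + (- b * c + - b * - d)
        ≈⟨ +-congˡ (distribˡ (- b) c (- d)) ⟨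
      a * (c + - d) + - b * (c + - d)
        ≈⟨ distribʳ (c + - d) a (- b) ⟨
      (a + - b) * (c + - d) ∎

    morphism : differences -Raw-AlmostCommutative⟶ fromCommutativeRing R
    morphism = record
      { ⟦_⟧    = ⟦_⟧
      ; +-homo = λ (a , b) (c , d) → begin
          ⟦ reduce (a ℕ.+ c) (b ℕ.+ d) ⟧
            ≈⟨ ⟦reduce⟧ (a ℕ.+ c) (b ℕ.+ d) ⟩
          (a ℕ.+ c) · 1# + - ((b ℕ.+ d) · 1#)
            ≈⟨ +-cong (×-homo-+ 1# a c) (-‿cong (×-homo-+ 1# b d)) ⟩
          (a · 1# + c · 1#) + - (b · 1# + d · 1#)
            ≈⟨ +-difference _ _ _ _ ⟩
          (a · 1# + - (b · 1#)) + (c · 1# + - (d · 1#))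
            ≈⟨ +-cong (⟦⟧-difference a b) (⟦⟧-difference c d) ⟨
          ⟦ a , b ⟧ + ⟦ c , d ⟧ ∎
      ; *-homo = λ (a , b) (c , d) → begin
          ⟦ reduce (a ℕ.* c ℕ.+ b ℕ.* d) (a ℕ.* d ℕ.+ b ℕ.* c) ⟧
            ≈⟨ ⟦reduce⟧ (a ℕ.* c ℕ.+ b ℕ.* d) (a ℕ.* d ℕ.+ b ℕ.* c) ⟩
          (a ℕ.* c ℕ.+ b ℕ.* d) · 1# + - ((a ℕ.* d ℕ.+ b ℕ.* c) · 1#)
            ≈⟨ +-cong (·-homo a c b d) (-‿cong (·-homo a d b c)) ⟩
          (a · 1# * c · 1# + b · 1# * d · 1#) + - (a · 1# * d · 1# + b · 1# * c · 1#)
            ≈⟨ *-difference _ _ _ _ ⟩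
          (a · 1# + - (b · 1#)) * (c · 1# + - (d · 1#))
            ≈⟨ *-cong (⟦⟧-difference a b) (⟦⟧-difference c d) ⟨
          ⟦ a , b ⟧ * ⟦ c , d ⟧ ∎
      ; -‿homo = λ (a , b) → begin
          ⟦ b , a ⟧                      ≈⟨ ⟦⟧-difference b a ⟩
          b · 1# + - (a · 1#)            ≈⟨ +-comm _ _ ⟩
          - (a · 1#) + b · 1#            ≈⟨ +-congˡ (-‿involutive _) ⟨
          - (a · 1#) + - - (b · 1#)      ≈⟨ ⁻¹-∙-comm _ _ ⟩
          - (a · 1# + - (b · 1#))        ≈⟨ -‿cong (⟦⟧-difference a b) ⟨
          - ⟦ a , b ⟧ ∎
      ; 0-homo = refl
      ; 1-homo = refl
      }
      where
      ·-homo : ∀ a c b d →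
        (a ℕ.* c ℕ.+ b ℕ.* d) · 1# ≈ a · 1# * c · 1# + b · 1# * d · 1#
      ·-homo a c b d = trans (×-homo-+ 1# (a ℕ.* c) (b ℕ.* d))
        (+-cong (×1-homo-* a c) (×1-homo-* b d))

    coefficients≟ : ∀ x y → Maybe (⟦ x ⟧ ≈ ⟦ y ⟧)
    coefficients≟ x y with ≡-dec ℕ._≟_ ℕ._≟_ x y
    ... | no _   = nothing
    ... | yes eq = just (reflexive (≡.cong ⟦_⟧ eq))

  open import Algebra.Solver.Ring differences (fromCommutativeRing R) morphism coefficients≟
    public using (Polynomial; solve; _:=_; _:+_; _:*_; _:-_; :-_; con; _:^_)

  :1 : ∀ {n} → Polynomial n
  :1 = con (1 , 0)

-- Triangular numbers with integer index

triangular : ℕ → ℕ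
triangular zero    = 0
triangular (suc n) = suc n ℕ.+ triangular n

-- T m = m (m + 1) / 2, also for negative m.
T : ℤ → ℕ
T (+ n)      = triangular n
T (-[1+ n ]) = triangular n

-- Identities between values of `T` are proved after doubling, where `T-double` makes them
-- polynomial identities over ℤ; this brings them back to ℕ.
double-injective : ∀ {x y} → + x ℤ.+ + x ≡ + y ℤ.+ + y → x ≡ y
double-injective {x} {y} eq = ℕ.*-cancelˡ-≡ x y 2 (begin
  2 ℕ.* x   ≡⟨ ≡.cong (x ℕ.+_) (ℕ.+-identityʳ x) ⟩
  x ℕ.+ x   ≡⟨ ℤ.+-injective eq ⟩
  y ℕ.+ y   ≡⟨ ≡.cong (y ℕ.+_) (ℕ.+-identityʳ y) ⟨
  2 ℕ.* y   ∎)
  where open ≡.≡-Reasoning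

triangular-double : ∀ n → + triangular n ℤ.+ + triangular n ≡ + n ℤ.* + n ℤ.+ + n
triangular-double zero    = ≡.refl
triangular-double (suc n) = begin
  (+ 1 ℤ.+ + n ℤ.+ t) ℤ.+ (+ 1 ℤ.+ + n ℤ.+ t)                       ≡⟨ regroup (+ n) t ⟩
  + 2 ℤ.+ + n ℤ.+ + n ℤ.+ (t ℤ.+ t)                                 ≡⟨ ≡.cong (λ x → + 2 ℤ.+ + n ℤ.+ + n ℤ.+ x) (triangular-double n) ⟩
  + 2 ℤ.+ + n ℤ.+ + n ℤ.+ (+ n ℤ.* + n ℤ.+ + n)                     ≡⟨ expand (+ n) ⟩
  (+ 1 ℤ.+ + n) ℤ.* (+ 1 ℤ.+ + n) ℤ.+ (+ 1 ℤ.+ + n)                 ∎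
  where
  open ≡.≡-Reasoning
  t = + triangular n
  regroup : ∀ x y → (+ 1 ℤ.+ x ℤ.+ y) ℤ.+ (+ 1 ℤ.+ x ℤ.+ y) ≡ + 2 ℤ.+ x ℤ.+ x ℤ.+ (y ℤ.+ y)
  regroup = ℤ-Solver.solve-∀
  expand : ∀ x → + 2 ℤ.+ x ℤ.+ x ℤ.+ (x ℤ.* x ℤ.+ x) ≡ (+ 1 ℤ.+ x) ℤ.* (+ 1 ℤ.+ x) ℤ.+ (+ 1 ℤ.+ x)
  expand = ℤ-Solver.solve-∀

T-double : ∀ m → + T m ℤ.+ + T m ≡ m ℤ.* m ℤ.+ m
T-double (+ n)    = triangular-double n
T-double -[1+ n ] = ≡.trans (triangular-double n) (reflect (+ n))
  where
  reflect : ∀ x → x ℤ.* x ℤ.+ x ≡ (ℤ.- (+ 1 ℤ.+ x)) ℤ.* (ℤ.- (+ 1 ℤ.+ x)) ℤ.+ (ℤ.- (+ 1 ℤ.+ x))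
  reflect = ℤ-Solver.solve-∀

n≤triangular : ∀ n → n ≤ triangular n
n≤triangular zero    = ℕ.z≤n
n≤triangular (suc n) = ℕ.m≤m+n (suc n) _

-- `T m` and `T (- m)` are the two exponents of the m-th theta term. One of them is at least ∣m∣, so
-- for nilpotent arguments all terms far from 0 vanish.
∣m∣≤T : ∀ m → ℤ.∣ m ∣ ≤ T m ⊎ ℤ.∣ m ∣ ≤ T (ℤ.- m)
∣m∣≤T (+ n)    = inj₁ (n≤triangular n)
∣m∣≤T -[1+ n ] = inj₂ (n≤triangular (suc n))

-- Finite products, geometric sums and sums over i + j = n

module FiniteSums {c ℓ} (R : CommutativeRing c ℓ) where
  open CommutativeRing R hiding (zero)
  open IntegerCoefficients R
  open import Relation.Binary.Reasoning.Setoid setoid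
  open import Algebra.Properties.CommutativeSemiring.Exp commutativeSemiring public
  open import Algebra.Properties.CommutativeSemigroup
    (CommutativeRing.*-commutativeSemigroup R) using () renaming (interchange to *-interchange)
  open import Algebra.Properties.CommutativeSemigroup
    (CommutativeRing.+-commutativeSemigroup R) using (x∙yz≈y∙xz)
    renaming (interchange to +-interchange)

  ∏ : ℕ → (ℕ → Carrier) → Carrier
  ∏ zero    f = 1#
  ∏ (suc n) f = ∏ n f * f n

  ∏-cong : ∀ n {f g} → (∀ i → f i ≈ g i) → ∏ n f ≈ ∏ n g
  ∏-cong zero    f≈g = refl
  ∏-cong (suc n) f≈g = *-cong (∏-cong n f≈g) (f≈g n)

  ∏-* : ∀ n f g → ∏ n (λ i → f i * g i) ≈ ∏ n f * ∏ n g
  ∏-* zero    f g = sym (*-identityˡ 1#)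
  ∏-* (suc n) f g = trans (*-congʳ (∏-* n f g)) (*-interchange (∏ n f) (∏ n g) (f n) (g n))

  ∏-+ : ∀ m n f → ∏ (n ℕ.+ m) f ≈ ∏ m f * ∏ n (λ j → f (j ℕ.+ m))
  ∏-+ m zero    f = sym (*-identityʳ _)
  ∏-+ m (suc n) f = trans (*-congʳ (∏-+ m n f)) (*-assoc _ _ _)

  ∏-blocks : ∀ n m f → ∏ (n ℕ.* m) f ≈ ∏ n (λ i → ∏ m (λ j → f (j ℕ.+ i ℕ.* m)))
  ∏-blocks zero    m f = refl
  ∏-blocks (suc n) m f = trans (∏-+ (n ℕ.* m) m f) (*-congʳ (∏-blocks n m f))

  ∏-stable : ∀ {m n f} → m ≤ n → (∀ i → m ≤ i → f i ≈ 1#) → ∏ n f ≈ ∏ m f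
  ∏-stable {m} {n} {f} m≤n f≈1 = trans (reflexive (≡.cong (λ k → ∏ k f) (≡.sym (ℕ.m∸n+n≡m m≤n)))) (stable (n ℕ.∸ m))
    where
    stable : ∀ k → ∏ (k ℕ.+ m) f ≈ ∏ m f
    stable zero    = refl
    stable (suc k) = trans (*-cong (stable k) (f≈1 (k ℕ.+ m) (ℕ.m≤n+m m k))) (*-identityʳ _)

  unit-cancelˡ : ∀ {x x⁻¹ y z} → x * x⁻¹ ≈ 1# → x * y ≈ x * z → y ≈ z
  unit-cancelˡ {x} {x⁻¹} {y} {z} xx⁻¹≈1 xy≈xz = begin
    y                ≈⟨ undo y ⟨
    x⁻¹ * (x * y)    ≈⟨ *-congˡ xy≈xz ⟩
    x⁻¹ * (x * z)    ≈⟨ undo z ⟩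
    z                ∎
    where
    undo : ∀ u → x⁻¹ * (x * u) ≈ u
    undo u = trans (trans (sym (*-assoc _ _ _)) (*-congʳ (trans (*-comm _ _) xx⁻¹≈1))) (*-identityˡ u)

  1^n≈1 : ∀ n → 1# ^ n ≈ 1#
  1^n≈1 zero    = refl
  1^n≈1 (suc n) = trans (*-identityˡ _) (1^n≈1 n)

  ∏-ones : ∀ n → ∏ n (λ _ → 1#) ≈ 1#
  ∏-ones zero    = refl
  ∏-ones (suc n) = trans (*-identityʳ _) (∏-ones n)

  ∏-unit : ∀ n {f g} → (∀ i → f i * g i ≈ 1#) → ∏ n f * ∏ n g ≈ 1#
  ∏-unit n {f} {g} inverse = trans (sym (∏-* n f g)) (trans (∏-cong n inverse) (∏-ones n))

  ∏-swap : ∀ m n (f : ℕ → ℕ → Carrier) → ∏ m (λ i → ∏ n (f i)) ≈ ∏ n (λ j → ∏ m (λ i → f i j))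
  ∏-swap zero    n f = sym (∏-ones n)
  ∏-swap (suc m) n f = trans (*-congʳ (∏-swap m n f)) (sym (∏-* n _ (f m)))

  ∏-^ : ∀ m k f → ∏ m (λ i → f i ^ k) ≈ ∏ m f ^ k
  ∏-^ zero    k f = sym (1^n≈1 k)
  ∏-^ (suc m) k f = trans (*-congʳ (∏-^ m k f)) (sym (^-distrib-* _ _ k))

  geometric : ℕ → Carrier → Carrier
  geometric zero    x = 0#
  geometric (suc k) x = 1# + x * geometric k x

  geometric-telescopes : ∀ k x → (1# - x) * geometric k x ≈ 1# - x ^ k
  geometric-telescopes zero    x = trans (zeroʳ _) (sym (-‿inverseʳ 1#))
  geometric-telescopes (suc k) x = begin
    (1# - x) * (1# + x * geometric k x)           ≈⟨ solve 2 (λ x g → (:1 :- x) :* (:1 :+ x :* g)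
                                                       := :1 :- x :+ x :* ((:1 :- x) :* g)) refl x _ ⟩
    1# - x + x * ((1# - x) * geometric k x)       ≈⟨ +-congˡ (*-congˡ (geometric-telescopes k x)) ⟩
    1# - x + x * (1# - x ^ k)                     ≈⟨ solve 2 (λ x y → :1 :- x :+ x :* (:1 :- y)
                                                       := :1 :- x :* y) refl x _ ⟩
    1# - x ^ suc k                                ∎

  ^-zero-mono : ∀ {x d e} → x ^ d ≈ 0# → d ≤ e → x ^ e ≈ 0#
  ^-zero-mono {x} {d} {e} x^d≈0 d≤e = begin
    x ^ e                  ≡⟨ ≡.cong (x ^_) (ℕ.m+[n∸m]≡n d≤e) ⟨
    x ^ (d ℕ.+ (e ℕ.∸ d))  ≈⟨ ^-homo-* x d _ ⟩
    x ^ d * x ^ (e ℕ.∸ d)  ≈⟨ *-congʳ x^d≈0 ⟩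
    0# * x ^ (e ℕ.∸ d)     ≈⟨ zeroˡ _ ⟩
    0#                     ∎

  *-zero-^ : ∀ {x d} y → x ^ d ≈ 0# → (x * y) ^ d ≈ 0#
  *-zero-^ {x} {d} y x^d≈0 = trans (^-distrib-* x y d) (trans (*-congʳ x^d≈0) (zeroˡ _))

  -- Sum of f i j over i + j = n.
  antidiagonal : ℕ → (ℕ → ℕ → Carrier) → Carrier
  antidiagonal zero    f = f 0 0
  antidiagonal (suc n) f = f 0 (suc n) + antidiagonal n (λ i → f (suc i))

  antidiagonal-cong : ∀ n {f g} → (∀ i j → i ℕ.+ j ≡ n → f i j ≈ g i j) →
                      antidiagonal n f ≈ antidiagonal n g
  antidiagonal-cong zero    f≈g = f≈g 0 0 ≡.refl
  antidiagonal-cong (suc n) f≈g = +-cong (f≈g 0 (suc n) ≡.refl)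
    (antidiagonal-cong n (λ i j i+j≡n → f≈g (suc i) j (≡.cong suc i+j≡n)))

  antidiagonal-last : ∀ n f → antidiagonal (suc n) f ≈ f (suc n) 0 + antidiagonal n (λ i j → f i (suc j))
  antidiagonal-last zero    f = +-comm _ _
  antidiagonal-last (suc n) f = trans (+-congˡ (antidiagonal-last n (λ i → f (suc i)))) (x∙yz≈y∙xz _ _ _)

  antidiagonal-swap : ∀ n f → antidiagonal n f ≈ antidiagonal n (λ i j → f j i)
  antidiagonal-swap zero    f = refl
  antidiagonal-swap (suc n) f = trans (antidiagonal-last n f)
    (+-congˡ (antidiagonal-swap n (λ i j → f i (suc j))))

  antidiagonal-+ : ∀ n f g → antidiagonal n (λ i j → f i j + g i j) ≈ antidiagonal n f + antidiagonal n g
  antidiagonal-+ zero    f g = refl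
  antidiagonal-+ (suc n) f g = trans
    (+-congˡ (antidiagonal-+ n (λ i → f (suc i)) (λ i → g (suc i)))) (+-interchange _ _ _ _)

  antidiagonal-*ˡ : ∀ n x f → x * antidiagonal n f ≈ antidiagonal n (λ i j → x * f i j)
  antidiagonal-*ˡ zero    x f = refl
  antidiagonal-*ˡ (suc n) x f = trans (distribˡ _ _ _) (+-congˡ (antidiagonal-*ˡ n x _))

  -- Both sums are moved to the longer antidiagonal, `α` one step in i and `β` one step in j, and
  -- padded with zeros. On the border only one of them contributes, which is why three hypotheses
  -- are needed.
  antidiagonal-pascal : ∀ n f α β →
    (∀ i → f (suc i) 0 ≈ α i 0) → (∀ j → f 0 (suc j) ≈ β 0 j) →
    (∀ i j → f (suc i) (suc j) ≈ α i (suc j) + β (suc i) j) →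
    antidiagonal (suc n) f ≈ antidiagonal n α + antidiagonal n β
  antidiagonal-pascal n f α β f≈α f≈β f≈α+β = begin
    antidiagonal (suc n) f                                  ≈⟨ antidiagonal-cong (suc n) split ⟩
    antidiagonal (suc n) (λ i j → left i j + right i j)     ≈⟨ antidiagonal-+ (suc n) left right ⟩
    antidiagonal (suc n) left + antidiagonal (suc n) right  ≈⟨ +-cong (+-identityˡ _) (antidiagonal-last n right) ⟩
    antidiagonal n α + (0# + antidiagonal n β)              ≈⟨ +-congˡ (+-identityˡ _) ⟩
    antidiagonal n α + antidiagonal n β                     ∎
    where
    left right : ℕ → ℕ → Carrier
    left zero    j = 0#
    left (suc i) j = α i j
    right i zero    = 0#
    right i (suc j) = β i j
    split : ∀ i j → i ℕ.+ j ≡ suc n → f i j ≈ left i j + right i j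
    split zero    (suc j) _ = trans (f≈β j) (sym (+-identityˡ _))
    split (suc i) zero    _ = trans (f≈α i) (sym (+-identityʳ _))
    split (suc i) (suc j) _ = f≈α+β i j

-- This is T (1 + m) = T m + m + 1. Since m may be negative, it enters only as the difference of the
-- naturals x and i.
T-suc : ∀ m {x i} → + x ≡ + i ℤ.+ m → suc x ℕ.+ T m ≡ i ℕ.+ T (+ 1 ℤ.+ m)
T-suc m {x} {i} x≡i+m = double-injective (begin
  (+ 1 ℤ.+ + x ℤ.+ t) ℤ.+ (+ 1 ℤ.+ + x ℤ.+ t)  ≡⟨ regroup (+ x) t ⟩
  (+ 2 ℤ.+ + x ℤ.+ + x) ℤ.+ (t ℤ.+ t)          ≡⟨ ≡.cong₂ (λ x y → (+ 2 ℤ.+ x ℤ.+ x) ℤ.+ y) x≡i+m (T-double m) ⟩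
  _                                            ≡⟨ expand (+ i) m ⟩
  + i ℤ.+ + i ℤ.+ (m′ ℤ.* m′ ℤ.+ m′)           ≡⟨ ≡.cong (λ x → + i ℤ.+ + i ℤ.+ x) (T-double m′) ⟨
  + i ℤ.+ + i ℤ.+ (t′ ℤ.+ t′)                  ≡⟨ ungroup (+ i) t′ ⟩
  (+ i ℤ.+ t′) ℤ.+ (+ i ℤ.+ t′)                ∎)
  where
  open ≡.≡-Reasoning
  m′ = + 1 ℤ.+ m
  t = + T m
  t′ = + T m′
  regroup : ∀ x y → (+ 1 ℤ.+ x ℤ.+ y) ℤ.+ (+ 1 ℤ.+ x ℤ.+ y) ≡ (+ 2 ℤ.+ x ℤ.+ x) ℤ.+ (y ℤ.+ y)
  regroup = ℤ-Solver.solve-∀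
  expand : ∀ x m → (+ 2 ℤ.+ (x ℤ.+ m) ℤ.+ (x ℤ.+ m)) ℤ.+ (m ℤ.* m ℤ.+ m)
                 ≡ x ℤ.+ x ℤ.+ ((+ 1 ℤ.+ m) ℤ.* (+ 1 ℤ.+ m) ℤ.+ (+ 1 ℤ.+ m))
  expand = ℤ-Solver.solve-∀
  ungroup : ∀ x y → x ℤ.+ x ℤ.+ (y ℤ.+ y) ≡ (x ℤ.+ y) ℤ.+ (x ℤ.+ y)
  ungroup = ℤ-Solver.solve-∀

-- `T-suc` at the index -(1 + m), read backwards.
T-neg-suc : ∀ m {x i} → + x ≡ + i ℤ.+ m → x ℕ.+ T (ℤ.- m) ≡ i ℕ.+ T (ℤ.- (+ 1 ℤ.+ m))
T-neg-suc m {x} {i} x≡i+m = ℕ.suc-injective (≡.sym (begin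
  suc (i ℕ.+ T (ℤ.- (+ 1 ℤ.+ m)))     ≡⟨ T-suc (ℤ.- (+ 1 ℤ.+ m)) {i} {suc x} i≡ ⟩
  suc x ℕ.+ T (+ 1 ℤ.+ ℤ.- (+ 1 ℤ.+ m)) ≡⟨ ≡.cong (λ y → suc x ℕ.+ T y) (cancel m) ⟩
  suc x ℕ.+ T (ℤ.- m)                 ∎))
  where
  open ≡.≡-Reasoning
  cancel : ∀ m → + 1 ℤ.+ ℤ.- (+ 1 ℤ.+ m) ≡ ℤ.- m
  cancel = ℤ-Solver.solve-∀
  solved : ∀ i m → i ≡ + 1 ℤ.+ (i ℤ.+ m) ℤ.+ ℤ.- (+ 1 ℤ.+ m)
  solved = ℤ-Solver.solve-∀
  i≡ : + i ≡ + 1 ℤ.+ + x ℤ.+ ℤ.- (+ 1 ℤ.+ m)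
  i≡ = ≡.trans (solved (+ i) m) (≡.cong (λ y → + 1 ℤ.+ y ℤ.+ ℤ.- (+ 1 ℤ.+ m)) (≡.sym x≡i+m))

m+n≡o+p⇒m≡o+[p⊖n] : ∀ m n o p → m ℕ.+ n ≡ o ℕ.+ p → + m ≡ + o ℤ.+ (p ⊖ n)
m+n≡o+p⇒m≡o+[p⊖n] m n o p eq = begin
  + m                            ≡⟨ cancel (+ m) (+ n) ⟩
  + (m ℕ.+ n) ℤ.- + n            ≡⟨ ≡.cong (λ x → + x ℤ.- + n) eq ⟩
  + o ℤ.+ + p ℤ.- + n            ≡⟨ ℤ.+-assoc (+ o) (+ p) (ℤ.- + n) ⟩
  + o ℤ.+ (+ p ℤ.- + n)          ≡⟨ ≡.cong (λ x → + o ℤ.+ x) (ℤ.[+m]-[+n]≡m⊖n p n) ⟩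
  + o ℤ.+ (p ⊖ n)                ∎
  where
  open ≡.≡-Reasoning
  cancel : ∀ x y → x ≡ x ℤ.+ y ℤ.- y
  cancel = ℤ-Solver.solve-∀

-- Jacobi's triple product

module TripleProduct {c ℓ} (R : CommutativeRing c ℓ) where
  open CommutativeRing R hiding (zero)
  open IntegerCoefficients R
  open FiniteSums R
  open import Relation.Binary.Reasoning.Setoid setoid
  open import Algebra.Properties.CommutativeSemigroup
    (CommutativeRing.*-commutativeSemigroup R)
    using (x∙yz≈y∙xz) renaming (interchange to *-interchange)

  -- The m-th term of Ramanujan's theta function f(a, b).
  θ-term : Carrier → Carrier → ℤ → Carrier
  θ-term a b m = a ^ T m * b ^ T (ℤ.- m)

  ^-*-θ : ∀ {a b p} i s t → a * b ≈ p → p ^ i * (a ^ s * b ^ t) ≈ a ^ (i ℕ.+ s) * b ^ (i ℕ.+ t)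
  ^-*-θ {a} {b} {p} i s t ab≈p = begin
    p ^ i * (a ^ s * b ^ t)                 ≈⟨ *-congʳ (^-congˡ i ab≈p) ⟨
    (a * b) ^ i * (a ^ s * b ^ t)           ≈⟨ *-congʳ (^-distrib-* a b i) ⟩
    (a ^ i * b ^ i) * (a ^ s * b ^ t)       ≈⟨ *-interchange _ _ _ _ ⟩
    (a ^ i * a ^ s) * (b ^ i * b ^ t)       ≈⟨ *-cong (^-homo-* a i s) (^-homo-* b i t) ⟨
    a ^ (i ℕ.+ s) * b ^ (i ℕ.+ t)           ∎

  -- Consecutive theta terms have quotient a^(m+1) b^m = a p^m. With m = j - M = N - i, the power
  -- p^m is distributed over both sides to keep the exponents natural.
  θ-term-shift : ∀ {a b p} N M i j → a * b ≈ p → i ℕ.+ j ≡ N ℕ.+ M →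
    a * p ^ N * θ-term a b (j ⊖ M) ≈ p ^ i * θ-term a b (suc j ⊖ M)
  θ-term-shift {a} {b} {p} N M i j ab≈p i+j≡N+M = begin
    a * p ^ N * θ-term a b m                             ≈⟨ *-assoc _ _ _ ⟩
    a * (p ^ N * θ-term a b m)                           ≈⟨ *-congˡ (^-*-θ N _ _ ab≈p) ⟩
    a * (a ^ (N ℕ.+ T m) * b ^ (N ℕ.+ T (ℤ.- m)))        ≈⟨ *-assoc _ _ _ ⟨
    a ^ (suc N ℕ.+ T m) * b ^ (N ℕ.+ T (ℤ.- m))          ≡⟨ ≡.cong₂ (λ x y → a ^ x * b ^ y) (T-suc m N≡) (T-neg-suc m N≡) ⟩
    a ^ (i ℕ.+ T (+ 1 ℤ.+ m)) * b ^ (i ℕ.+ T (ℤ.- (+ 1 ℤ.+ m)))  ≈⟨ ^-*-θ i _ _ ab≈p ⟨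
    p ^ i * θ-term a b (+ 1 ℤ.+ m)                       ≡⟨ ≡.cong (λ x → p ^ i * θ-term a b x) (ℤ.distribʳ-⊖-+-pos 1 j M) ⟩
    p ^ i * θ-term a b (suc j ⊖ M)                       ∎
    where
    m = j ⊖ M
    N≡ : + N ≡ + i ℤ.+ m
    N≡ = m+n≡o+p⇒m≡o+[p⊖n] N M i j (≡.sym i+j≡N+M)

  θ-term-flip : ∀ {a b} N M i j → i ℕ.+ j ≡ N ℕ.+ M → θ-term b a (i ⊖ N) ≈ θ-term a b (j ⊖ M)
  θ-term-flip {a} {b} N M i j i+j≡N+M = trans (*-comm _ _)
    (reflexive (≡.cong₂ (λ x y → a ^ T x * b ^ T y) flip
      (≡.trans (≡.sym (ℤ.neg-involutive (i ⊖ N))) (≡.cong ℤ.-_ flip))))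
    where
    flip : ℤ.- (i ⊖ N) ≡ j ⊖ M
    flip = ≡.trans (≡.sym (ℤ.⊖-swap N i)) (≡.trans (≡.sym (ℤ.+-cancelˡ-⊖ M N i))
      (≡.trans (≡.cong₂ _⊖_ (≡.trans (ℕ.+-comm M N) (≡.trans (≡.sym i+j≡N+M) (ℕ.+-comm i j))) (ℕ.+-comm M i))
        (≡.trans (≡.cong (_⊖ (i ℕ.+ M)) (ℕ.+-comm j i)) (ℤ.+-cancelˡ-⊖ i j M))))

  module _ (p : Carrier) (d : ℕ) (p^d≈0 : p ^ d ≈ 0#) where

    -- The Pochhammer product (p ; p)_n and its inverse: as p^d = 0, every geometric series for 1/(1
    -- - p^i) stops after d terms, so q-binomials may be defined as quotients.
    poch poch⁻¹ : ℕ → Carrier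
    poch   n = ∏ n (λ i → 1# - p ^ suc i)
    poch⁻¹ n = ∏ n (λ i → geometric d (p ^ suc i))

    1-p^i-inverse : ∀ i → (1# - p ^ suc i) * geometric d (p ^ suc i) ≈ 1#
    1-p^i-inverse i = begin
      (1# - p ^ suc i) * geometric d (p ^ suc i)   ≈⟨ geometric-telescopes d (p ^ suc i) ⟩
      1# - (p ^ suc i) ^ d                         ≈⟨ +-congˡ (-‿cong (*-zero-^ {p} {d} (p ^ i) p^d≈0)) ⟩
      1# - 0#                                      ≈⟨ solve 0 (:1 :- con (0 , 0) := :1) refl ⟩
      1#                                           ∎

    poch-inverse : ∀ n → poch n * poch⁻¹ n ≈ 1#
    poch-inverse n = ∏-unit n 1-p^i-inverse

    qbinomial : ℕ → ℕ → Carrier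
    qbinomial i j = poch (i ℕ.+ j) * (poch⁻¹ i * poch⁻¹ j)

    poch⁻¹-suc : ∀ n → poch⁻¹ n ≈ (1# - p ^ suc n) * poch⁻¹ (suc n)
    poch⁻¹-suc n = begin
      poch⁻¹ n                                                            ≈⟨ *-identityʳ _ ⟨
      poch⁻¹ n * 1#                                                       ≈⟨ *-congˡ (1-p^i-inverse n) ⟨
      poch⁻¹ n * ((1# - p ^ suc n) * geometric d (p ^ suc n))             ≈⟨ x∙yz≈y∙xz _ _ _ ⟩
      (1# - p ^ suc n) * poch⁻¹ (suc n)                                   ∎

    qbinomial-0ˡ : ∀ j → qbinomial 0 j ≈ 1#
    qbinomial-0ˡ j = trans (*-congˡ (*-identityˡ _)) (poch-inverse j)

    qbinomial-comm : ∀ i j → qbinomial i j ≈ qbinomial j i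
    qbinomial-comm i j = *-cong (reflexive (≡.cong poch (ℕ.+-comm i j))) (*-comm _ _)

    qbinomial-0ʳ : ∀ i → qbinomial i 0 ≈ 1#
    qbinomial-0ʳ i = trans (qbinomial-comm i 0) (qbinomial-0ˡ i)

    -- With a = p^(i+1) and b = p^(j+1), this is 1 - a b = (1 - a) + a (1 - b): each bracket on the
    -- right shortens one of the inverse Pochhammer products by a factor.
    qbinomial-pascal : ∀ i j →
      qbinomial (suc i) (suc j) ≈ qbinomial i (suc j) + qbinomial (suc i) j * p ^ suc i
    qbinomial-pascal i j = begin
      poch (suc i ℕ.+ suc j) * (x * y)                                     ≡⟨⟩
      (poch (i ℕ.+ suc j) * (1# - p ^ suc (i ℕ.+ suc j))) * (x * y)
        ≈⟨ *-congʳ (*-congˡ (+-congˡ (-‿cong (^-homo-* p (suc i) (suc j))))) ⟩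
      (z * (1# - a * b)) * (x * y)
        ≈⟨ solve 5 (λ z a b x y → (z :* (:1 :- a :* b)) :* (x :* y)
             := z :* (((:1 :- a) :* x) :* y) :+ z :* (x :* ((:1 :- b) :* y)) :* a) refl z a b x y ⟩
      z * (((1# - a) * x) * y) + z * (x * ((1# - b) * y)) * a
        ≈⟨ +-cong (*-congˡ (*-congʳ (poch⁻¹-suc i)))
             (*-congʳ (*-cong (reflexive (≡.cong poch (≡.sym (ℕ.+-suc i j)))) (*-congˡ (poch⁻¹-suc j)))) ⟨
      qbinomial i (suc j) + qbinomial (suc i) j * p ^ suc i                ∎
      where
      x = poch⁻¹ (suc i)
      y = poch⁻¹ (suc j)
      z = poch (i ℕ.+ suc j)
      a = p ^ suc i
      b = p ^ suc j

    -- Cauchy's finite form of the triple product; for M = 0 it is the q-binomial theorem.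
    -- Independent N and M allow an induction that adds a single factor at a time.
    FiniteTripleProduct : Carrier → Carrier → ℕ → ℕ → Set ℓ
    FiniteTripleProduct a b N M =
      ∏ N (λ i → 1# + a * p ^ i) * ∏ M (λ i → 1# + b * p ^ i)
        ≈ antidiagonal (N ℕ.+ M) (λ i j → qbinomial i j * θ-term a b (j ⊖ M))

    finite-step : ∀ {a b} N M → a * b ≈ p →
      FiniteTripleProduct a b N M → FiniteTripleProduct a b (suc N) M
    finite-step {a} {b} N M ab≈p ih = begin
      (∏ N (λ i → 1# + a * p ^ i) * (1# + a * p ^ N)) * Y
        ≈⟨ solve 3 (λ x c y → (x :* (:1 :+ c)) :* y := x :* y :+ c :* (x :* y)) refl _ _ Y ⟩
      ∏ N (λ i → 1# + a * p ^ i) * Y + a * p ^ N * (∏ N (λ i → 1# + a * p ^ i) * Y)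
        ≈⟨ +-cong ih (*-congˡ ih) ⟩
      antidiagonal K old + a * p ^ N * antidiagonal K old
        ≈⟨ +-congˡ (trans (antidiagonal-*ˡ K _ old) (antidiagonal-cong K shift)) ⟩
      antidiagonal K old + antidiagonal K shifted
        ≈⟨ antidiagonal-pascal K new old shifted
             (λ i → *-congʳ (trans (qbinomial-0ʳ (suc i)) (sym (qbinomial-0ʳ i))))
             (λ j → trans (*-congʳ (trans (qbinomial-0ˡ (suc j)) (sym (qbinomial-0ˡ j))))
                      (*-congˡ (sym (*-identityˡ _))))
             pascal ⟨
      antidiagonal (suc K) new ∎
      where
      K = N ℕ.+ M
      Y = ∏ M (λ i → 1# + b * p ^ i)
      old new shifted : ℕ → ℕ → Carrier
      old     i j = qbinomial i j * θ-term a b (j ⊖ M)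
      new     i j = qbinomial i j * θ-term a b (j ⊖ M)
      shifted i j = qbinomial i j * (p ^ i * θ-term a b (suc j ⊖ M))
      shift : ∀ i j → i ℕ.+ j ≡ K → a * p ^ N * old i j ≈ shifted i j
      shift i j i+j≡K = trans (x∙yz≈y∙xz _ _ _) (*-congˡ (θ-term-shift N M i j ab≈p i+j≡K))
      pascal : ∀ i j → new (suc i) (suc j) ≈ old i (suc j) + shifted (suc i) j
      pascal i j = trans (*-congʳ (qbinomial-pascal i j))
        (trans (distribʳ _ _ _) (+-congˡ (*-assoc _ _ _)))

    finite-swap : ∀ {a b} N M → FiniteTripleProduct a b N M → FiniteTripleProduct b a M N
    finite-swap {a} {b} N M ih = begin
      ∏ M (λ i → 1# + b * p ^ i) * ∏ N (λ i → 1# + a * p ^ i)      ≈⟨ *-comm _ _ ⟩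
      ∏ N (λ i → 1# + a * p ^ i) * ∏ M (λ i → 1# + b * p ^ i)      ≈⟨ ih ⟩
      antidiagonal (N ℕ.+ M) (λ i j → qbinomial i j * θ-term a b (j ⊖ M))
        ≈⟨ antidiagonal-cong (N ℕ.+ M) (λ i j i+j≡ →
             *-cong (qbinomial-comm j i) (θ-term-flip N M i j i+j≡)) ⟨
      antidiagonal (N ℕ.+ M) (λ i j → qbinomial j i * θ-term b a (i ⊖ N))
        ≈⟨ antidiagonal-swap (N ℕ.+ M) (λ i j → qbinomial j i * θ-term b a (i ⊖ N)) ⟩
      antidiagonal (N ℕ.+ M) (λ i j → qbinomial i j * θ-term b a (j ⊖ N))
        ≡⟨ ≡.cong (λ k → antidiagonal k (λ i j → qbinomial i j * θ-term b a (j ⊖ N))) (ℕ.+-comm N M) ⟩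
      antidiagonal (M ℕ.+ N) (λ i j → qbinomial i j * θ-term b a (j ⊖ N)) ∎

    finite-triple-product : ∀ {a b} → a * b ≈ p → ∀ N M → FiniteTripleProduct a b N M
    finite-triple-product {a} {b} ab≈p zero    zero = begin
      1# * 1#                               ≈⟨ *-congʳ (qbinomial-0ˡ 0) ⟨
      qbinomial 0 0 * 1#                    ≈⟨ *-congˡ (*-identityˡ 1#) ⟨
      qbinomial 0 0 * (1# * 1#)             ∎
    -- A factor in b is added as a factor in a for the exchanged pair (b , a).
    finite-triple-product ab≈p zero    (suc M) = finite-swap (suc M) zero
      (finite-step M zero (trans (*-comm _ _) ab≈p) (finite-swap zero M (finite-triple-product ab≈p zero M)))
    finite-triple-product ab≈p (suc N) M = finite-step N M ab≈p (finite-triple-product ab≈p N M)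

-- Takes x out of `ys`. Distinctness keeps x out of `xs`, so `xs` still lies in what is left; this
-- is the induction step for comparing sums over nested lists.
Unique-split : ∀ {a} {A : Set a} {x : A} {xs ys} → Unique (x ∷ xs) → x ∷ xs ⊆ ys → Unique ys →
               ∃[ zs ] ys ↭ x ∷ zs × xs ⊆ zs × Unique (x ∷ zs)
Unique-split {x = x} {xs} x∷xs! x∷xs⊆ys ys! with ∈-∃++ (x∷xs⊆ys (here ≡.refl))
... | pre , post , ≡.refl = pre ++ post , perm , xs⊆zs , zs!
  where
  perm = ↭.shift x pre post
  zs! : Unique (x ∷ pre ++ post)
  zs! = ↭ₛ.Unique-resp-↭ (≡.setoid _) (↭⇒↭ₛ perm) ys!
  xs⊆zs : xs ⊆ pre ++ post
  xs⊆zs v∈xs with ↭.∈-resp-↭ perm (x∷xs⊆ys (there v∈xs))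
  ... | here ≡.refl = contradiction v∈xs (Unique.Unique[x∷xs]⇒x∉xs x∷xs!)
  ... | there v∈zs  = v∈zs

-- Diagonals of a square of integer points

interval : ℕ → List ℤ
interval N = map (_⊖ N) (upTo (suc (N ℕ.+ N)))

⊖-injectiveˡ : ∀ n {i j} → i ⊖ n ≡ j ⊖ n → i ≡ j
⊖-injectiveˡ n {i} {j} eq = ℤ.+-injective (begin
  + i                  ≡⟨ cancel (+ i) (+ n) ⟩
  + i ℤ.- + n ℤ.+ + n  ≡⟨ ≡.cong (ℤ._+ + n) (ℤ.[+m]-[+n]≡m⊖n i n) ⟩
  i ⊖ n ℤ.+ + n        ≡⟨ ≡.cong (ℤ._+ + n) eq ⟩
  j ⊖ n ℤ.+ + n        ≡⟨ ≡.cong (ℤ._+ + n) (ℤ.[+m]-[+n]≡m⊖n j n) ⟨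
  + j ℤ.- + n ℤ.+ + n  ≡⟨ cancel (+ j) (+ n) ⟨
  + j                  ∎)
  where
  open ≡.≡-Reasoning
  cancel : ∀ x y → x ≡ x ℤ.- y ℤ.+ y
  cancel = ℤ-Solver.solve-∀

interval! : ∀ N → Unique (interval N)
interval! N = Unique.map⁺ (⊖-injectiveˡ N) (Unique.upTo⁺ _)

∈-interval⁺ : ∀ N m → ℤ.∣ m ∣ ≤ N → m ∈ interval N
∈-interval⁺ N (+ k) k≤N = ≡.subst (_∈ interval N)
  (≡.trans (ℤ.⊖-≥ (ℕ.m≤m+n N k)) (≡.cong +_ (ℕ.m+n∸m≡n N k)))
  (∈-map⁺ (_⊖ N) (∈-upTo⁺ (ℕ.s≤s (ℕ.+-monoʳ-≤ N k≤N))))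
∈-interval⁺ N -[1+ k ] 1+k≤N = ≡.subst (_∈ interval N)
  (≡.trans (ℤ.⊖-≤ (ℕ.m∸n≤m N (suc k))) (≡.cong (ℤ.-_ ∘ +_) (ℕ.m∸[m∸n]≡n 1+k≤N)))
  (∈-map⁺ (_⊖ N) (∈-upTo⁺ (ℕ.s≤s (ℕ.≤-trans (ℕ.m∸n≤m N (suc k)) (ℕ.m≤m+n N N)))))

∣⊖∣≤ : ∀ {i N} → i ≤ N ℕ.+ N → ℤ.∣ i ⊖ N ∣ ≤ N
∣⊖∣≤ {i} {N} i≤2N with ℕ.≤-total i N
... | inj₁ i≤N = ℕ.≤-trans (ℕ.≤-reflexive (ℤ.∣⊖∣-≤ i≤N)) (ℕ.m∸n≤m N i)
... | inj₂ N≤i = ℕ.≤-trans (ℕ.≤-reflexive (≡.trans (ℤ.∣m⊖n∣≡∣n⊖m∣ i N) (ℤ.∣⊖∣-≤ N≤i)))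
                   (ℕ.m≤n+o⇒m∸n≤o i N i≤2N)

∈-interval⁻ : ∀ N {m} → m ∈ interval N → ℤ.∣ m ∣ ≤ N
∈-interval⁻ N m∈ with ∈-map⁻ (_⊖ N) m∈
... | i , i∈ , ≡.refl = ∣⊖∣≤ (ℕ.≤-pred (∈-upTo⁻ i∈))

parity : ∀ m → ∃[ h ] (m ≡ h ℤ.+ h ⊎ m ≡ + 1 ℤ.+ (h ℤ.+ h))
parity (+ n)    = [ (λ (k , eq) → + k , inj₁ (≡.cong +_ eq)) , (λ (k , eq) → + k , inj₂ (≡.cong +_ eq)) ]′ (ℕ-parity n)
  where
  ℕ-parity : ∀ n → (∃[ k ] n ≡ k ℕ.+ k) ⊎ (∃[ k ] n ≡ suc (k ℕ.+ k))
  ℕ-parity zero    = inj₁ (0 , ≡.refl)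
  ℕ-parity (suc n) with ℕ-parity n
  ... | inj₁ (k , ≡.refl) = inj₂ (k , ≡.refl)
  ... | inj₂ (k , ≡.refl) = inj₁ (suc k , ≡.cong suc (≡.sym (ℕ.+-suc k k)))
parity -[1+ n ] with parity (+ n)
... | h , inj₁ n≡2h   = ℤ.- (+ 1 ℤ.+ h) , inj₂ (≡.trans (≡.cong (λ x → ℤ.- (+ 1 ℤ.+ x)) n≡2h) (solved h))
  where
  solved : ∀ h → ℤ.- (+ 1 ℤ.+ (h ℤ.+ h)) ≡ + 1 ℤ.+ (ℤ.- (+ 1 ℤ.+ h) ℤ.+ ℤ.- (+ 1 ℤ.+ h))
  solved = ℤ-Solver.solve-∀
... | h , inj₂ n≡1+2h = ℤ.- (+ 1 ℤ.+ h) , inj₁ (≡.trans (≡.cong (λ x → ℤ.- (+ 1 ℤ.+ x)) n≡1+2h) (solved h))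
  where
  solved : ∀ h → ℤ.- (+ 1 ℤ.+ (+ 1 ℤ.+ (h ℤ.+ h))) ≡ ℤ.- (+ 1 ℤ.+ h) ℤ.+ ℤ.- (+ 1 ℤ.+ h)
  solved = ℤ-Solver.solve-∀

∣x+x∣ : ∀ x → ℤ.∣ x ℤ.+ x ∣ ≡ ℤ.∣ x ∣ ℕ.+ ℤ.∣ x ∣
∣x+x∣ (+ n)    = ≡.refl
∣x+x∣ -[1+ n ] = ≡.cong suc (≡.sym (ℕ.+-suc n n))

n+n≢1 : ∀ n → n ℕ.+ n ≢ 1
n+n≢1 (suc zero)    ()
n+n≢1 (suc (suc n)) ()

x+x≢1+y+y : ∀ x y → x ℤ.+ x ≢ + 1 ℤ.+ (y ℤ.+ y)
x+x≢1+y+y x y eq = n+n≢1 ℤ.∣ x ℤ.- y ∣ (≡.trans (≡.sym (∣x+x∣ (x ℤ.- y))) (≡.cong ℤ.∣_∣ (begin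
  (x ℤ.- y) ℤ.+ (x ℤ.- y)           ≡⟨ regroup x y ⟩
  (x ℤ.+ x) ℤ.- (y ℤ.+ y)           ≡⟨ ≡.cong (ℤ._- (y ℤ.+ y)) eq ⟩
  + 1 ℤ.+ (y ℤ.+ y) ℤ.- (y ℤ.+ y)   ≡⟨ cancel y ⟩
  + 1                               ∎)))
  where
  open ≡.≡-Reasoning
  regroup : ∀ x y → (x ℤ.- y) ℤ.+ (x ℤ.- y) ≡ (x ℤ.+ x) ℤ.- (y ℤ.+ y)
  regroup = ℤ-Solver.solve-∀
  cancel : ∀ y → + 1 ℤ.+ (y ℤ.+ y) ℤ.- (y ℤ.+ y) ≡ + 1
  cancel = ℤ-Solver.solve-∀

+-double-injective : ∀ {x y} → x ℤ.+ x ≡ y ℤ.+ y → x ≡ y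
+-double-injective {x} {y} eq = ℤ.*-cancelˡ-≡ (+ 2) x y (≡.trans (2* x) (≡.trans eq (≡.sym (2* y))))
  where
  2* : ∀ x → + 2 ℤ.* x ≡ x ℤ.+ x
  2* = ℤ-Solver.solve-∀

m+m≤1+n+n⇒m≤n : ∀ {m n} → m ℕ.+ m ≤ suc (n ℕ.+ n) → m ≤ n
m+m≤1+n+n⇒m≤n {m} {n} m+m≤ with ℕ.≤-<-connex m n
... | inj₁ m≤n = m≤n
... | inj₂ n<m = contradiction
    (ℕ.≤-trans (≡.subst (_≤ m ℕ.+ m) (≡.cong suc (ℕ.+-suc n n)) (ℕ.+-mono-≤ n<m n<m)) m+m≤)
    (ℕ.<-irrefl ≡.refl)

-- The slack of 1 serves the odd diagonals, where doubled coordinates are only bounded by 2N + 1; by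
-- parity the half is still at most N.
half-bound : ∀ N x → ℤ.∣ x ℤ.+ x ∣ ≤ suc (N ℕ.+ N) → ℤ.∣ x ∣ ≤ N
half-bound N x x+x≤ = m+m≤1+n+n⇒m≤n (≡.subst (_≤ _) (∣x+x∣ x) x+x≤)

-- Coordinates on the points (m , n) with m + n even (-2k) and odd (1 + 2k). The signs fix the order
-- of the two arguments in the resulting theta series: a series arising from even diagonals in one
-- product and from odd ones in another has the same form both times.
evenDiagonal oddDiagonal : ℤ × ℤ → ℤ × ℤ
evenDiagonal (k , l) = l ℤ.- k , ℤ.- k ℤ.- l
oddDiagonal  (k , l) = k ℤ.- l , + 1 ℤ.+ (k ℤ.+ l)

evenDiagonal-injective : ∀ {x y} → evenDiagonal x ≡ evenDiagonal y → x ≡ y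
evenDiagonal-injective {k , l} {k′ , l′} eq with ,-injective eq
... | eq₁ , eq₂ = ≡.cong₂ _,_
  (+-double-injective (≡.trans (k+k k l) (≡.trans (≡.cong₂ (λ u v → ℤ.- u ℤ.- v) eq₁ eq₂) (≡.sym (k+k k′ l′)))))
  (+-double-injective (≡.trans (l+l k l) (≡.trans (≡.cong₂ (λ u v → u ℤ.- v) eq₁ eq₂) (≡.sym (l+l k′ l′)))))
  where
  k+k : ∀ k l → k ℤ.+ k ≡ ℤ.- (l ℤ.- k) ℤ.- (ℤ.- k ℤ.- l)
  k+k = ℤ-Solver.solve-∀
  l+l : ∀ k l → l ℤ.+ l ≡ (l ℤ.- k) ℤ.- (ℤ.- k ℤ.- l)
  l+l = ℤ-Solver.solve-∀

oddDiagonal-injective : ∀ {x y} → oddDiagonal x ≡ oddDiagonal y → x ≡ y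
oddDiagonal-injective {k , l} {k′ , l′} eq with ,-injective eq
... | eq₁ , eq₂ = ≡.cong₂ _,_
  (+-double-injective (≡.trans (k+k k l) (≡.trans (≡.cong₂ (λ u v → u ℤ.+ v ℤ.- + 1) eq₁ eq₂) (≡.sym (k+k k′ l′)))))
  (+-double-injective (≡.trans (l+l k l) (≡.trans (≡.cong₂ (λ u v → v ℤ.- u ℤ.- + 1) eq₁ eq₂) (≡.sym (l+l k′ l′)))))
  where
  k+k : ∀ k l → k ℤ.+ k ≡ (k ℤ.- l) ℤ.+ (+ 1 ℤ.+ (k ℤ.+ l)) ℤ.- + 1
  k+k = ℤ-Solver.solve-∀
  l+l : ∀ k l → l ℤ.+ l ≡ (+ 1 ℤ.+ (k ℤ.+ l)) ℤ.- (k ℤ.- l) ℤ.- + 1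
  l+l = ℤ-Solver.solve-∀

-- The two coordinates of an image add up to -2k in the one case and to 1 + 2k′ in the other.
evenDiagonal≢oddDiagonal : ∀ x y → evenDiagonal x ≢ oddDiagonal y
evenDiagonal≢oddDiagonal (k , l) (k′ , l′) eq with ,-injective eq
... | eq₁ , eq₂ = x+x≢1+y+y (ℤ.- k) k′ (≡.trans (even k l) (≡.trans (≡.cong₂ ℤ._+_ eq₁ eq₂) (odd k′ l′)))
  where
  even : ∀ k l → ℤ.- k ℤ.+ ℤ.- k ≡ (l ℤ.- k) ℤ.+ (ℤ.- k ℤ.- l)
  even = ℤ-Solver.solve-∀
  odd : ∀ k l → (k ℤ.- l) ℤ.+ (+ 1 ℤ.+ (k ℤ.+ l)) ≡ + 1 ℤ.+ (k ℤ.+ k)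
  odd = ℤ-Solver.solve-∀

square diagonals : ℕ → List (ℤ × ℤ)
square N    = cartesianProduct (interval N) (interval N)
diagonals N = map evenDiagonal (square N) ++ map oddDiagonal (square N)

square! : ∀ N → Unique (square N)
square! N = Unique.cartesianProduct⁺ (interval! N) (interval! N)

diagonals! : ∀ N → Unique (diagonals N)
diagonals! N = Unique.++⁺ (Unique.map⁺ {f = evenDiagonal} (λ {x} → evenDiagonal-injective {x}) (square! N))
  (Unique.map⁺ {f = oddDiagonal} (λ {x} → oddDiagonal-injective {x}) (square! N)) disjoint
  where
  disjoint : ∀ {v} → v ∈ map evenDiagonal (square N) × v ∈ map oddDiagonal (square N) → ⊥
  disjoint (v∈₁ , v∈₂) with ∈-map⁻ evenDiagonal {xs = square N} v∈₁ | ∈-map⁻ oddDiagonal {xs = square N} v∈₂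
  ... | x , _ , v≡x | y , _ , v≡y = evenDiagonal≢oddDiagonal x y (≡.trans (≡.sym v≡x) v≡y)

-- The parity of m + n selects the family, and its half h gives the preimage: (-h , m - h) or (h , h
-- - m). The doubled coordinates are ±(m + n) and m - n, or m + n - 1 and n - m - 1, so `half-bound`
-- keeps the preimage in the square.
square⊆diagonals : ∀ N → square N ⊆ diagonals N
square⊆diagonals N {m , n} mn∈ with ∈-cartesianProduct⁻ (interval N) (interval N) mn∈
... | m∈ , n∈ with parity (m ℤ.+ n)
... | h , inj₁ m+n≡2h = ∈-++⁺ˡ (≡.subst (_∈ map evenDiagonal (square N)) (≡.cong₂ _,_ (fst h m)
    (≡.trans (snd h m) (≡.trans (≡.cong (ℤ._- m) (≡.sym m+n≡2h)) (cancel m n))))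
    (∈-map⁺ evenDiagonal (∈-cartesianProduct⁺
      (∈-interval⁺ N (ℤ.- h) (half-bound N (ℤ.- h) (bound (≡.trans (neg h) (≡.cong ℤ.-_ (≡.sym m+n≡2h)))
        (ℕ.≤-trans (ℕ.≤-reflexive (ℤ.∣-i∣≡∣i∣ (m ℤ.+ n))) (ℤ.∣i+j∣≤∣i∣+∣j∣ m n)))))
      (∈-interval⁺ N (m ℤ.- h) (half-bound N (m ℤ.- h) (bound
        (≡.trans (double m h) (≡.trans (≡.cong (λ x → m ℤ.+ m ℤ.- x) (≡.sym m+n≡2h)) (difference m n)))
        (ℤ.∣i-j∣≤∣i∣+∣j∣ m n)))))))
  where
  bound : ∀ {x y} → x ≡ y → ℤ.∣ y ∣ ≤ ℤ.∣ m ∣ ℕ.+ ℤ.∣ n ∣ → ℤ.∣ x ∣ ≤ suc (N ℕ.+ N)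
  bound ≡.refl y≤ = ℕ.m≤n⇒m≤1+n (ℕ.≤-trans y≤ (ℕ.+-mono-≤ (∈-interval⁻ N m∈) (∈-interval⁻ N n∈)))
  fst : ∀ h m → (m ℤ.- h) ℤ.- (ℤ.- h) ≡ m
  fst = ℤ-Solver.solve-∀
  snd : ∀ h m → ℤ.- (ℤ.- h) ℤ.- (m ℤ.- h) ≡ (h ℤ.+ h) ℤ.- m
  snd = ℤ-Solver.solve-∀
  cancel : ∀ m n → m ℤ.+ n ℤ.- m ≡ n
  cancel = ℤ-Solver.solve-∀
  neg : ∀ h → ℤ.- h ℤ.+ ℤ.- h ≡ ℤ.- (h ℤ.+ h)
  neg = ℤ-Solver.solve-∀
  double : ∀ m h → (m ℤ.- h) ℤ.+ (m ℤ.- h) ≡ m ℤ.+ m ℤ.- (h ℤ.+ h)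
  double = ℤ-Solver.solve-∀
  difference : ∀ m n → m ℤ.+ m ℤ.- (m ℤ.+ n) ≡ m ℤ.- n
  difference = ℤ-Solver.solve-∀
... | h , inj₂ m+n≡1+2h = ∈-++⁺ʳ (map evenDiagonal (square N))
    (≡.subst (_∈ map oddDiagonal (square N)) (≡.cong₂ _,_ (fst h m)
    (≡.trans (snd h m) (≡.trans (≡.cong (ℤ._- m) (≡.sym m+n≡1+2h)) (cancel m n))))
    (∈-map⁺ oddDiagonal (∈-cartesianProduct⁺
      (∈-interval⁺ N h (half-bound N h (bound {y = m ℤ.+ n} (≡.trans (pred h) (≡.cong (ℤ._- + 1) (≡.sym m+n≡1+2h)))
        (ℤ.∣i+j∣≤∣i∣+∣j∣ m n))))
      (∈-interval⁺ N (h ℤ.- m) (half-bound N (h ℤ.- m) (bound {y = n ℤ.- m}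
        (≡.trans (double m h) (≡.trans (≡.cong (λ x → x ℤ.- (m ℤ.+ m) ℤ.- + 1) (≡.sym m+n≡1+2h)) (difference m n)))
        (ℕ.≤-trans (ℕ.≤-reflexive (ℤ.∣i-j∣≡∣j-i∣ n m)) (ℤ.∣i-j∣≤∣i∣+∣j∣ m n))))))))
  where
  bound : ∀ {x y} → x ≡ y ℤ.- + 1 → ℤ.∣ y ∣ ≤ ℤ.∣ m ∣ ℕ.+ ℤ.∣ n ∣ → ℤ.∣ x ∣ ≤ suc (N ℕ.+ N)
  bound {y = y} ≡.refl y≤ = ℕ.≤-trans (ℤ.∣i-j∣≤∣i∣+∣j∣ y (+ 1)) (ℕ.≤-trans (ℕ.≤-reflexive (ℕ.+-comm _ 1))
    (ℕ.s≤s (ℕ.≤-trans y≤ (ℕ.+-mono-≤ (∈-interval⁻ N m∈) (∈-interval⁻ N n∈)))))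
  fst : ∀ h m → h ℤ.- (h ℤ.- m) ≡ m
  fst = ℤ-Solver.solve-∀
  snd : ∀ h m → + 1 ℤ.+ (h ℤ.+ (h ℤ.- m)) ≡ + 1 ℤ.+ (h ℤ.+ h) ℤ.- m
  snd = ℤ-Solver.solve-∀
  cancel : ∀ m n → m ℤ.+ n ℤ.- m ≡ n
  cancel = ℤ-Solver.solve-∀
  pred : ∀ h → h ℤ.+ h ≡ + 1 ℤ.+ (h ℤ.+ h) ℤ.- + 1
  pred = ℤ-Solver.solve-∀
  double : ∀ m h → (h ℤ.- m) ℤ.+ (h ℤ.- m) ≡ + 1 ℤ.+ (h ℤ.+ h) ℤ.- (m ℤ.+ m) ℤ.- + 1
  double = ℤ-Solver.solve-∀
  difference : ∀ m n → m ℤ.+ n ℤ.- (m ℤ.+ m) ℤ.- + 1 ≡ n ℤ.- m ℤ.- + 1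
  difference = ℤ-Solver.solve-∀

-- Sums over lists and the rearrangement along diagonals

module ListSums {c ℓ} (R : CommutativeRing c ℓ) where
  open CommutativeRing R hiding (zero)
  open FiniteSums R using (antidiagonal; antidiagonal-swap)
  open import Relation.Binary.Reasoning.Setoid setoid
  open import Algebra.Properties.CommutativeSemigroup
    (CommutativeRing.+-commutativeSemigroup R) using (x∙yz≈y∙xz)

  ∑ : ∀ {a} {A : Set a} → List A → (A → Carrier) → Carrier
  ∑ []       f = 0#
  ∑ (x ∷ xs) f = f x + ∑ xs f

  module _ {a} {A : Set a} where

    ∑-cong : ∀ xs {f g : A → Carrier} → (∀ x → f x ≈ g x) → ∑ xs f ≈ ∑ xs g
    ∑-cong []       f≈g = refl
    ∑-cong (x ∷ xs) f≈g = +-cong (f≈g x) (∑-cong xs f≈g)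

    ∑-zero : ∀ xs {f : A → Carrier} → (∀ {x} → x ∈ xs → f x ≈ 0#) → ∑ xs f ≈ 0#
    ∑-zero []       f≈0 = refl
    ∑-zero (x ∷ xs) f≈0 = trans (+-cong (f≈0 (here ≡.refl)) (∑-zero xs (f≈0 ∘ there))) (+-identityˡ 0#)

    ∑-++ : ∀ xs ys (f : A → Carrier) → ∑ (xs ++ ys) f ≈ ∑ xs f + ∑ ys f
    ∑-++ []       ys f = sym (+-identityˡ _)
    ∑-++ (x ∷ xs) ys f = trans (+-congˡ (∑-++ xs ys f)) (sym (+-assoc _ _ _))

    ∑-*ˡ : ∀ xs y (f : A → Carrier) → y * ∑ xs f ≈ ∑ xs (λ x → y * f x)
    ∑-*ˡ []       y f = zeroʳ y
    ∑-*ˡ (x ∷ xs) y f = trans (distribˡ _ _ _) (+-congˡ (∑-*ˡ xs y f))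

    ∑-*ʳ : ∀ xs y (f : A → Carrier) → ∑ xs f * y ≈ ∑ xs (λ x → f x * y)
    ∑-*ʳ []       y f = zeroˡ y
    ∑-*ʳ (x ∷ xs) y f = trans (distribʳ _ _ _) (+-congˡ (∑-*ʳ xs y f))

    ∑-↭ : ∀ {xs ys} (f : A → Carrier) → xs ↭ ys → ∑ xs f ≈ ∑ ys f
    ∑-↭ f ↭.refl             = refl
    ∑-↭ f (↭.prep x p)       = +-congˡ (∑-↭ f p)
    ∑-↭ f (↭.swap x y p)     = trans (x∙yz≈y∙xz _ _ _) (+-congˡ (+-congˡ (∑-↭ f p)))
    ∑-↭ f (↭.trans p q)      = trans (∑-↭ f p) (∑-↭ f q)

    ∑-⊆ : ∀ {xs ys} (f : A → Carrier) → Unique xs → Unique ys → xs ⊆ ys →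
          (∀ {y} → y ∈ ys → y ∉ xs → f y ≈ 0#) → ∑ ys f ≈ ∑ xs f
    ∑-⊆ {[]}     {ys} f xs! ys! xs⊆ys f≈0 = ∑-zero ys (λ y∈ys → f≈0 y∈ys λ ())
    ∑-⊆ {x ∷ xs} {ys} f (x∉ ∷ xs!) ys! xs⊆ys f≈0 with Unique-split (x∉ ∷ xs!) xs⊆ys ys!
    ... | zs , perm , xs⊆zs , (x∉zs ∷ zs!) = trans (∑-↭ f perm) (+-congˡ (∑-⊆ f xs! zs! xs⊆zs vanish))
      where
      vanish : ∀ {y} → y ∈ zs → y ∉ xs → f y ≈ 0#
      vanish y∈zs y∉xs = f≈0 (↭.∈-resp-↭ (↭.↭-sym perm) (there y∈zs))
        λ { (here y≡x) → All.lookup x∉zs y∈zs (≡.sym y≡x) ; (there y∈xs) → y∉xs y∈xs }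

  ∑-map : ∀ {a b} {A : Set a} {B : Set b} (h : A → B) xs f → ∑ (map h xs) f ≈ ∑ xs (f ∘ h)
  ∑-map h []       f = refl
  ∑-map h (x ∷ xs) f = +-congˡ (∑-map h xs f)

  ∑-cartesianProduct : ∀ {a b} {A : Set a} {B : Set b} (xs : List A) (ys : List B) f →
    ∑ (cartesianProduct xs ys) f ≈ ∑ xs (λ x → ∑ ys (λ y → f (x , y)))
  ∑-cartesianProduct []       ys f = refl
  ∑-cartesianProduct (x ∷ xs) ys f = trans (∑-++ (map (x ,_) ys) _ f)
    (+-cong (∑-map (x ,_) ys f) (∑-cartesianProduct xs ys f))

  ∑-applyUpTo : ∀ {a} {A : Set a} (h : ℕ → A) n f →
    ∑ (applyUpTo h (suc n)) f ≈ antidiagonal n (λ i _ → f (h i))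
  ∑-applyUpTo h zero    f = +-identityʳ _
  ∑-applyUpTo h (suc n) f = +-congˡ (∑-applyUpTo (h ∘ suc) n f)

  ∑-interval : ∀ N f → antidiagonal (N ℕ.+ N) (λ _ j → f (j ⊖ N)) ≈ ∑ (interval N) f
  ∑-interval N f = begin
    antidiagonal (N ℕ.+ N) (λ _ j → f (j ⊖ N))    ≈⟨ antidiagonal-swap (N ℕ.+ N) _ ⟩
    antidiagonal (N ℕ.+ N) (λ i _ → f (i ⊖ N))    ≈⟨ ∑-applyUpTo id (N ℕ.+ N) (f ∘ (_⊖ N)) ⟨
    ∑ (upTo (suc (N ℕ.+ N))) (f ∘ (_⊖ N))         ≈⟨ ∑-map (_⊖ N) (upTo (suc (N ℕ.+ N))) f ⟨
    ∑ (interval N) f                              ∎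

  -- The two images of the square are disjoint and together contain the square; their surplus points
  -- lie outside it, where f vanishes. This makes the change of variables on ℤ² a comparison of
  -- finite lists.
  ∑-diagonals : ∀ N (f : ℤ × ℤ → Carrier) →
    (∀ m n → N < ℤ.∣ m ∣ ⊎ N < ℤ.∣ n ∣ → f (m , n) ≈ 0#) →
    ∑ (square N) f ≈ ∑ (square N) (f ∘ evenDiagonal) + ∑ (square N) (f ∘ oddDiagonal)
  ∑-diagonals N f f≈0 = begin
    ∑ (square N) f             ≈⟨ ∑-⊆ f (square! N) (diagonals! N) (square⊆diagonals N) (λ _ → outside _) ⟨
    ∑ (diagonals N) f          ≈⟨ ∑-++ (map evenDiagonal (square N)) _ f ⟩
    ∑ (map evenDiagonal (square N)) f + ∑ (map oddDiagonal (square N)) f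
      ≈⟨ +-cong (∑-map evenDiagonal (square N) f) (∑-map oddDiagonal (square N) f) ⟩
    ∑ (square N) (f ∘ evenDiagonal) + ∑ (square N) (f ∘ oddDiagonal) ∎
    where
    outside : ∀ y → y ∉ square N → f y ≈ 0#
    outside (m , n) mn∉ with ℤ.∣ m ∣ ℕ.≤? N | ℤ.∣ n ∣ ℕ.≤? N
    ... | yes m≤N | yes n≤N = contradiction (∈-cartesianProduct⁺ (∈-interval⁺ N m m≤N) (∈-interval⁺ N n n≤N)) mn∉
    ... | no  m≰N | _       = f≈0 m n (inj₁ (ℕ.≰⇒> m≰N))
    ... | _       | no  n≰N = f≈0 m n (inj₂ (ℕ.≰⇒> n≰N))

  ∑-*-∑ : ∀ {a b} {A : Set a} {B : Set b} (xs : List A) (ys : List B) f g →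
    ∑ xs f * ∑ ys g ≈ ∑ (cartesianProduct xs ys) (λ (x , y) → f x * g y)
  ∑-*-∑ xs ys f g = begin
    ∑ xs f * ∑ ys g                                        ≈⟨ ∑-*ʳ xs _ f ⟩
    ∑ xs (λ x → f x * ∑ ys g)                              ≈⟨ ∑-cong xs (λ x → ∑-*ˡ ys (f x) g) ⟩
    ∑ xs (λ x → ∑ ys (λ y → f x * g y))                    ≈⟨ ∑-cartesianProduct xs ys _ ⟨
    ∑ (cartesianProduct xs ys) (λ (x , y) → f x * g y)     ∎

-- Exponents in a product of two theta terms along the diagonals

T-combination : (c₁ : ℕ) (m₁ : ℤ) (c₂ : ℕ) (m₂ : ℤ) (c₃ : ℕ) (m₃ : ℤ) (c₄ : ℕ) (m₄ : ℤ) → ℕ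
T-combination c₁ m₁ c₂ m₂ c₃ m₃ c₄ m₄ =
  (c₁ ℕ.* T m₁ ℕ.+ c₂ ℕ.* T m₂) ℕ.+ (c₃ ℕ.* T m₃ ℕ.+ c₄ ℕ.* T m₄)

pronic : ℤ → ℤ
pronic m = m ℤ.* m ℤ.+ m

T-combination-double : ∀ c₁ m₁ c₂ m₂ c₃ m₃ c₄ m₄ → let e = + T-combination c₁ m₁ c₂ m₂ c₃ m₃ c₄ m₄ in
  e ℤ.+ e ≡ (+ c₁ ℤ.* pronic m₁ ℤ.+ + c₂ ℤ.* pronic m₂)
        ℤ.+ (+ c₃ ℤ.* pronic m₃ ℤ.+ + c₄ ℤ.* pronic m₄)
T-combination-double c₁ m₁ c₂ m₂ c₃ m₃ c₄ m₄ = begin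
  e ℤ.+ e                 ≡⟨ regroup (+ (c₁ ℕ.* T m₁)) (+ (c₂ ℕ.* T m₂)) (+ (c₃ ℕ.* T m₃)) (+ (c₄ ℕ.* T m₄)) ⟩
  _                       ≡⟨ ≡.cong₂ ℤ._+_ (≡.cong₂ ℤ._+_ (term c₁ m₁) (term c₂ m₂))
                                           (≡.cong₂ ℤ._+_ (term c₃ m₃) (term c₄ m₄)) ⟩
  _                       ∎
  where
  open ≡.≡-Reasoning
  e = + T-combination c₁ m₁ c₂ m₂ c₃ m₃ c₄ m₄
  regroup : ∀ a b c d → ((a ℤ.+ b) ℤ.+ (c ℤ.+ d)) ℤ.+ ((a ℤ.+ b) ℤ.+ (c ℤ.+ d))
                      ≡ ((a ℤ.+ a) ℤ.+ (b ℤ.+ b)) ℤ.+ ((c ℤ.+ c) ℤ.+ (d ℤ.+ d))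
  regroup = ℤ-Solver.solve-∀
  distrib : ∀ c t → c ℤ.* t ℤ.+ c ℤ.* t ≡ c ℤ.* (t ℤ.+ t)
  distrib = ℤ-Solver.solve-∀
  term : ∀ c m → + (c ℕ.* T m) ℤ.+ + (c ℕ.* T m) ≡ + c ℤ.* pronic m
  term c m = ≡.trans (≡.cong (λ x → x ℤ.+ x) (ℤ.pos-* c (T m)))
    (≡.trans (distrib (+ c) (+ T m)) (≡.cong (λ x → + c ℤ.* x) (T-double m)))

private
  module ℤ-Poly = Data.Integer.Solver.+-*-Solver

-- The exponent of one variable in a product of two theta terms: the cᵢ count that variable in the
-- four arguments on the diagonal, the eᵢ in the four arguments after separation. The offset c is 1
-- only for t on the odd diagonals, where a factor t is left over.
evenExponents oddExponents : (c₁ c₂ c₃ c₄ e₁ e₂ e₃ e₄ c : ℕ) → ℤ → ℤ → Set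
evenExponents c₁ c₂ c₃ c₄ e₁ e₂ e₃ e₄ c k l =
  T-combination c₁ (l ℤ.- k) c₂ (ℤ.- (l ℤ.- k)) c₃ (ℤ.- k ℤ.- l) c₄ (ℤ.- (ℤ.- k ℤ.- l))
    ≡ c ℕ.+ T-combination e₁ k e₂ (ℤ.- k) e₃ l e₄ (ℤ.- l)
oddExponents c₁ c₂ c₃ c₄ e₁ e₂ e₃ e₄ c k l =
  T-combination c₁ (k ℤ.- l) c₂ (ℤ.- (k ℤ.- l)) c₃ (+ 1 ℤ.+ (k ℤ.+ l)) c₄ (ℤ.- (+ 1 ℤ.+ (k ℤ.+ l)))
    ≡ c ℕ.+ T-combination e₁ k e₂ (ℤ.- k) e₃ l e₄ (ℤ.- l)

module _ where
  open ℤ-Poly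

  private
    :pronic : ∀ {n} → Polynomial n → Polynomial n
    :pronic m = m :* m :+ m

    :combination : ∀ {n} (c₁ : ℕ) (m₁ : Polynomial n) (c₂ : ℕ) (m₂ : Polynomial n)
                         (c₃ : ℕ) (m₃ : Polynomial n) (c₄ : ℕ) (m₄ : Polynomial n) → Polynomial n
    :combination c₁ m₁ c₂ m₂ c₃ m₃ c₄ m₄ =
      (con (+ c₁) :* :pronic m₁ :+ con (+ c₂) :* :pronic m₂)
      :+ (con (+ c₃) :* :pronic m₃ :+ con (+ c₄) :* :pronic m₄)

  double-combination : ∀ c {e} x₁ m₁ x₂ m₂ x₃ m₃ x₄ m₄ →
    + e ℤ.+ + e ≡ + (c ℕ.+ c) ℤ.+ ((+ x₁ ℤ.* pronic m₁ ℤ.+ + x₂ ℤ.* pronic m₂)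
                            ℤ.+ (+ x₃ ℤ.* pronic m₃ ℤ.+ + x₄ ℤ.* pronic m₄)) →
    e ≡ c ℕ.+ T-combination x₁ m₁ x₂ m₂ x₃ m₃ x₄ m₄
  double-combination c {e} x₁ m₁ x₂ m₂ x₃ m₃ x₄ m₄ eq = double-injective (≡.trans eq
    (≡.trans (≡.cong (λ x → + (c ℕ.+ c) ℤ.+ x) (≡.sym (T-combination-double x₁ m₁ x₂ m₂ x₃ m₃ x₄ m₄)))
      (interchange (+ c) (+ T-combination x₁ m₁ x₂ m₂ x₃ m₃ x₄ m₄))))
    where
    interchange : ∀ c e → (c ℤ.+ c) ℤ.+ (e ℤ.+ e) ≡ (c ℤ.+ e) ℤ.+ (c ℤ.+ e)
    interchange = ℤ-Solver.solve-∀

  -- Here (l - k)² + (k + l)² = 2k² + 2l²: the mixed term k l cancels, which is what separates the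
  -- variables. The other five exponents follow the same pattern.
  even-t-exponent : ∀ k l → evenExponents 1 1 1 1 2 2 2 2 0 k l
  even-t-exponent k l = double-combination 0 2 k 2 (ℤ.- k) 2 l 2 (ℤ.- l) (≡.trans
    (T-combination-double 1 (l ℤ.- k) 1 (ℤ.- (l ℤ.- k)) 1 (ℤ.- k ℤ.- l) 1 (ℤ.- (ℤ.- k ℤ.- l)))
    (solve 2 (λ k l → :combination 1 (l :- k) 1 (:- (l :- k)) 1 (:- k :- l) 1 (:- (:- k :- l))
      := con (+ 0) :+ :combination 2 k 2 (:- k) 2 l 2 (:- l)) ≡.refl k l))

  even-Z-exponent : ∀ k l → evenExponents 1 0 0 1 1 1 2 0 0 k l
  even-Z-exponent k l = double-combination 0 1 k 1 (ℤ.- k) 2 l 0 (ℤ.- l) (≡.trans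
    (T-combination-double 1 (l ℤ.- k) 0 (ℤ.- (l ℤ.- k)) 0 (ℤ.- k ℤ.- l) 1 (ℤ.- (ℤ.- k ℤ.- l)))
    (solve 2 (λ k l → :combination 1 (l :- k) 0 (:- (l :- k)) 0 (:- k :- l) 1 (:- (:- k :- l))
      := con (+ 0) :+ :combination 1 k 1 (:- k) 2 l 0 (:- l)) ≡.refl k l))

  even-B-exponent : ∀ k l → evenExponents 0 1 0 1 2 0 1 1 0 k l
  even-B-exponent k l = double-combination 0 2 k 0 (ℤ.- k) 1 l 1 (ℤ.- l) (≡.trans
    (T-combination-double 0 (l ℤ.- k) 1 (ℤ.- (l ℤ.- k)) 0 (ℤ.- k ℤ.- l) 1 (ℤ.- (ℤ.- k ℤ.- l)))
    (solve 2 (λ k l → :combination 0 (l :- k) 1 (:- (l :- k)) 0 (:- k :- l) 1 (:- (:- k :- l))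
      := con (+ 0) :+ :combination 2 k 0 (:- k) 1 l 1 (:- l)) ≡.refl k l))

  odd-t-exponent : ∀ k l → oddExponents 1 1 1 1 4 0 4 0 1 k l
  odd-t-exponent k l = double-combination 1 4 k 0 (ℤ.- k) 4 l 0 (ℤ.- l) (≡.trans
    (T-combination-double 1 (k ℤ.- l) 1 (ℤ.- (k ℤ.- l)) 1 (+ 1 ℤ.+ (k ℤ.+ l)) 1 (ℤ.- (+ 1 ℤ.+ (k ℤ.+ l))))
    (solve 2 (λ k l → :combination 1 (k :- l) 1 (:- (k :- l)) 1 (con (+ 1) :+ (k :+ l)) 1 (:- (con (+ 1) :+ (k :+ l)))
      := con (+ 2) :+ :combination 4 k 0 (:- k) 4 l 0 (:- l)) ≡.refl k l))

  odd-Z-exponent : ∀ k l → oddExponents 1 0 0 1 2 0 1 1 0 k l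
  odd-Z-exponent k l = double-combination 0 2 k 0 (ℤ.- k) 1 l 1 (ℤ.- l) (≡.trans
    (T-combination-double 1 (k ℤ.- l) 0 (ℤ.- (k ℤ.- l)) 0 (+ 1 ℤ.+ (k ℤ.+ l)) 1 (ℤ.- (+ 1 ℤ.+ (k ℤ.+ l))))
    (solve 2 (λ k l → :combination 1 (k :- l) 0 (:- (k :- l)) 0 (con (+ 1) :+ (k :+ l)) 1 (:- (con (+ 1) :+ (k :+ l)))
      := con (+ 0) :+ :combination 2 k 0 (:- k) 1 l 1 (:- l)) ≡.refl k l))

  odd-B-exponent : ∀ k l → oddExponents 0 1 0 1 1 1 2 0 0 k l
  odd-B-exponent k l = double-combination 0 1 k 1 (ℤ.- k) 2 l 0 (ℤ.- l) (≡.trans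
    (T-combination-double 0 (k ℤ.- l) 1 (ℤ.- (k ℤ.- l)) 0 (+ 1 ℤ.+ (k ℤ.+ l)) 1 (ℤ.- (+ 1 ℤ.+ (k ℤ.+ l))))
    (solve 2 (λ k l → :combination 0 (k :- l) 1 (:- (k :- l)) 0 (con (+ 1) :+ (k :+ l)) 1 (:- (con (+ 1) :+ (k :+ l)))
      := con (+ 0) :+ :combination 1 k 1 (:- k) 2 l 0 (:- l)) ≡.refl k l))

-- Products of two theta series

module ThetaProducts {c ℓ} (R : CommutativeRing c ℓ) where
  open CommutativeRing R hiding (zero)
  open IntegerCoefficients R
  open FiniteSums R
  open ListSums R
  open TripleProduct R
  open import Relation.Binary.Reasoning.Setoid setoid
  open import Algebra.Properties.CommutativeSemigroup
    (CommutativeRing.*-commutativeSemigroup R)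
    using () renaming (interchange to *-interchange)

  θ-term-cong : ∀ {a a′ b b′} → a ≈ a′ → b ≈ b′ → ∀ m → θ-term a b m ≈ θ-term a′ b′ m
  θ-term-cong a≈a′ b≈b′ m = *-cong (^-congˡ (T m) a≈a′) (^-congˡ (T (ℤ.- m)) b≈b′)

  θ-term-vanishes : ∀ {a b d m} → a ^ d ≈ 0# → b ^ d ≈ 0# → d ≤ ℤ.∣ m ∣ → θ-term a b m ≈ 0#
  θ-term-vanishes {m = m} a^d≈0 b^d≈0 d≤∣m∣ with ∣m∣≤T m
  ... | inj₁ ≤T = trans (*-congʳ (^-zero-mono a^d≈0 (ℕ.≤-trans d≤∣m∣ ≤T))) (zeroˡ _)
  ... | inj₂ ≤T = trans (*-congˡ (^-zero-mono b^d≈0 (ℕ.≤-trans d≤∣m∣ ≤T))) (zeroʳ _)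

  θ-sum : ℕ → Carrier → Carrier → Carrier
  θ-sum N a b = ∑ (interval N) (θ-term a b)

  θ-sum-cong : ∀ N {a a′ b b′} → a ≈ a′ → b ≈ b′ → θ-sum N a b ≈ θ-sum N a′ b′
  θ-sum-cong N a≈a′ b≈b′ = ∑-cong (interval N) (θ-term-cong a≈a′ b≈b′)

  module _ {p : Carrier} {d : ℕ} (p^d≈0 : p ^ d ≈ 0#) where

    poch-stable : ∀ {i} → d ≤ i → poch p d p^d≈0 i ≈ poch p d p^d≈0 d
    poch-stable d≤i = ∏-stable d≤i (λ k d≤k → trans
      (+-congˡ (-‿cong (^-zero-mono p^d≈0 (ℕ.m≤n⇒m≤1+n d≤k)))) (solve 0 (:1 :- con (0 , 0) := :1) refl))

    -- If i and j are both at least d, all Pochhammer products in sight agree with the one of length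
    -- d, so multiplying by `poch` turns the q-binomial into 1. If one of them is below d, then j is
    -- at distance at least d from N because 2d ≤ N, and the theta term itself is 0.
    triple-product : ∀ {a b} N → a * b ≈ p → a ^ d ≈ 0# → b ^ d ≈ 0# → d ℕ.+ d ≤ N →
      poch p d p^d≈0 (N ℕ.+ N) * (∏ N (λ i → 1# + a * p ^ i) * ∏ N (λ i → 1# + b * p ^ i)) ≈ θ-sum N a b
    triple-product {a} {b} N ab≈p a^d≈0 b^d≈0 2d≤N = begin
      P (N ℕ.+ N) * (∏ N (λ i → 1# + a * p ^ i) * ∏ N (λ i → 1# + b * p ^ i))
        ≈⟨ *-congˡ (finite-triple-product p d p^d≈0 ab≈p N N) ⟩
      P (N ℕ.+ N) * antidiagonal (N ℕ.+ N) (λ i j → qbinomial p d p^d≈0 i j * θ-term a b (j ⊖ N))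
        ≈⟨ antidiagonal-*ˡ (N ℕ.+ N) _ _ ⟩
      antidiagonal (N ℕ.+ N) (λ i j → P (N ℕ.+ N) * (qbinomial p d p^d≈0 i j * θ-term a b (j ⊖ N)))
        ≈⟨ antidiagonal-cong (N ℕ.+ N) simplify ⟩
      antidiagonal (N ℕ.+ N) (λ _ j → θ-term a b (j ⊖ N))
        ≈⟨ ∑-interval N (θ-term a b) ⟩
      θ-sum N a b ∎
      where
      P = poch p d p^d≈0
      P⁻¹ = poch⁻¹ p d p^d≈0
      d≤N : d ≤ N
      d≤N = ℕ.≤-trans (ℕ.m≤m+n d d) 2d≤N
      d≤N∸d : d ≤ N ℕ.∸ d
      d≤N∸d = ℕ.m+n≤o⇒m≤o∸n d 2d≤N
      both-vanish : ∀ {x y} j → d ≤ ℤ.∣ j ⊖ N ∣ → x * (y * θ-term a b (j ⊖ N)) ≈ θ-term a b (j ⊖ N)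
      both-vanish j d≤ = trans (*-congˡ (trans (*-congˡ vanish) (zeroʳ _))) (trans (zeroʳ _) (sym vanish))
        where vanish = θ-term-vanishes {m = j ⊖ N} a^d≈0 b^d≈0 d≤
      simplify : ∀ i j → i ℕ.+ j ≡ N ℕ.+ N →
        P (N ℕ.+ N) * (qbinomial p d p^d≈0 i j * θ-term a b (j ⊖ N)) ≈ θ-term a b (j ⊖ N)
      simplify i j i+j≡2N with ℕ.≤-<-connex d i | ℕ.≤-<-connex d j
      ... | inj₁ d≤i | inj₁ d≤j = begin
        P (N ℕ.+ N) * (P (i ℕ.+ j) * (P⁻¹ i * P⁻¹ j) * θ)
          ≈⟨ *-cong (trans (stable (ℕ.≤-trans d≤N (ℕ.m≤m+n N N))) (sym (stable d≤i)))
               (*-congʳ (*-congʳ (trans (stable (ℕ.≤-trans d≤i (ℕ.m≤m+n i j))) (sym (stable d≤j))))) ⟩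
        P i * (P j * (P⁻¹ i * P⁻¹ j) * θ)
          ≈⟨ solve 5 (λ x y z w t → x :* (y :* (z :* w) :* t) := (x :* z) :* ((y :* w) :* t)) refl _ _ _ _ _ ⟩
        (P i * P⁻¹ i) * ((P j * P⁻¹ j) * θ)
          ≈⟨ *-cong (poch-inverse p d p^d≈0 i) (*-congʳ (poch-inverse p d p^d≈0 j)) ⟩
        1# * (1# * θ)
          ≈⟨ trans (*-identityˡ _) (*-identityˡ _) ⟩
        θ ∎
        where
        θ = θ-term a b (j ⊖ N)
        stable = poch-stable
      ... | inj₂ i<d | _ = both-vanish j (≡.subst (d ≤_) (≡.sym (≡.trans (ℤ.∣m⊖n∣≡∣n⊖m∣ j N) (ℤ.∣⊖∣-≤ N≤j))) d≤j∸N)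
        where
        j≡ : j ≡ N ℕ.+ N ℕ.∸ i
        j≡ = ≡.trans (≡.sym (ℕ.m+n∸m≡n i j)) (≡.cong (ℕ._∸ i) i+j≡2N)
        N+d≤j : d ℕ.+ N ≤ j
        N+d≤j = ≡.subst (d ℕ.+ N ≤_) (≡.sym j≡) (ℕ.m+n≤o⇒m≤o∸n (d ℕ.+ N)
          (ℕ.≤-trans (ℕ.≤-reflexive (swap d N i)) (ℕ.≤-trans (ℕ.+-monoˡ-≤ N (ℕ.+-monoʳ-≤ d (ℕ.<⇒≤ i<d))) (ℕ.+-monoˡ-≤ N 2d≤N))))
          where
          swap : ∀ d N i → d ℕ.+ N ℕ.+ i ≡ d ℕ.+ i ℕ.+ N
          swap d N i = ≡.trans (ℕ.+-assoc d N i) (≡.trans (≡.cong (d ℕ.+_) (ℕ.+-comm N i)) (≡.sym (ℕ.+-assoc d i N)))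
        N≤j : N ≤ j
        N≤j = ℕ.≤-trans (ℕ.m≤n+m N d) N+d≤j
        d≤j∸N : d ≤ j ℕ.∸ N
        d≤j∸N = ℕ.m+n≤o⇒m≤o∸n d N+d≤j
      ... | _ | inj₂ j<d = both-vanish j (≡.subst (d ≤_) (≡.sym (ℤ.∣⊖∣-≤ (ℕ.≤-trans (ℕ.<⇒≤ j<d) d≤N)))
        (ℕ.≤-trans d≤N∸d (ℕ.∸-monoʳ-≤ N (ℕ.<⇒≤ j<d))))

  -- Two theta products f(a₁, b₁) and f(a₂, b₂) with a₁ b₁ = a₂ b₂ are parametrised by a₂ = t, a₁ = Z t,
  -- b₁ = B t, b₂ = Z B t; then every exponent occurring below is a natural number.
  module _ (t Z B : Carrier) where

    monomial : ℕ → ℕ → ℕ → Carrier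
    monomial i j k = t ^ i * (Z ^ j * B ^ k)

    monomial-* : ∀ i j k i′ j′ k′ →
      monomial i j k * monomial i′ j′ k′ ≈ monomial (i ℕ.+ i′) (j ℕ.+ j′) (k ℕ.+ k′)
    monomial-* i j k i′ j′ k′ = begin
      (t ^ i * (Z ^ j * B ^ k)) * (t ^ i′ * (Z ^ j′ * B ^ k′))     ≈⟨ *-interchange _ _ _ _ ⟩
      (t ^ i * t ^ i′) * ((Z ^ j * B ^ k) * (Z ^ j′ * B ^ k′))     ≈⟨ *-congˡ (*-interchange _ _ _ _) ⟩
      (t ^ i * t ^ i′) * ((Z ^ j * Z ^ j′) * (B ^ k * B ^ k′))
        ≈⟨ *-cong (^-homo-* t i i′) (*-cong (^-homo-* Z j j′) (^-homo-* B k k′)) ⟨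
      monomial (i ℕ.+ i′) (j ℕ.+ j′) (k ℕ.+ k′)                    ∎

    monomial-^ : ∀ i j k n → monomial i j k ^ n ≈ monomial (i ℕ.* n) (j ℕ.* n) (k ℕ.* n)
    monomial-^ i j k n = trans (^-distrib-* _ _ n) (*-cong (^-assocʳ t i n)
      (trans (^-distrib-* _ _ n) (*-cong (^-assocʳ Z j n) (^-assocʳ B k n))))

    monomial-cong : ∀ {i j k i′ j′ k′} → i ≡ i′ → j ≡ j′ → k ≡ k′ → monomial i j k ≈ monomial i′ j′ k′
    monomial-cong ≡.refl ≡.refl ≡.refl = refl

    θ-term-monomial : ∀ i j k i′ j′ k′ m → θ-term (monomial i j k) (monomial i′ j′ k′) m
      ≈ monomial (i ℕ.* T m ℕ.+ i′ ℕ.* T (ℤ.- m)) (j ℕ.* T m ℕ.+ j′ ℕ.* T (ℤ.- m)) (k ℕ.* T m ℕ.+ k′ ℕ.* T (ℤ.- m))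
    θ-term-monomial i j k i′ j′ k′ m = trans
      (*-cong (monomial-^ i j k (T m)) (monomial-^ i′ j′ k′ (T (ℤ.- m))))
      (monomial-* (i ℕ.* T m) (j ℕ.* T m) (k ℕ.* T m) (i′ ℕ.* T (ℤ.- m)) (j′ ℕ.* T (ℤ.- m)) (k′ ℕ.* T (ℤ.- m)))

    θ-terms-monomial : ∀ i j k i′ j′ k′ m u v w u′ v′ w′ n →
      θ-term (monomial i j k) (monomial i′ j′ k′) m * θ-term (monomial u v w) (monomial u′ v′ w′) n
        ≈ monomial (T-combination i m i′ (ℤ.- m) u n u′ (ℤ.- n))
                   (T-combination j m j′ (ℤ.- m) v n v′ (ℤ.- n))
                   (T-combination k m k′ (ℤ.- m) w n w′ (ℤ.- n))
    θ-terms-monomial i j k i′ j′ k′ m u v w u′ v′ w′ n = trans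
      (*-cong (θ-term-monomial i j k i′ j′ k′ m) (θ-term-monomial u v w u′ v′ w′ n))
      (monomial-* (i ℕ.* T m ℕ.+ i′ ℕ.* T (ℤ.- m)) (j ℕ.* T m ℕ.+ j′ ℕ.* T (ℤ.- m)) (k ℕ.* T m ℕ.+ k′ ℕ.* T (ℤ.- m))
                  (u ℕ.* T n ℕ.+ u′ ℕ.* T (ℤ.- n)) (v ℕ.* T n ℕ.+ v′ ℕ.* T (ℤ.- n)) (w ℕ.* T n ℕ.+ w′ ℕ.* T (ℤ.- n)))

    even-term : ∀ k l →
      θ-term (monomial 1 1 0) (monomial 1 0 1) (l ℤ.- k) * θ-term (monomial 1 0 0) (monomial 1 1 1) (ℤ.- k ℤ.- l)
        ≈ θ-term (monomial 2 1 2) (monomial 2 1 0) k * θ-term (monomial 2 2 1) (monomial 2 0 1) l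
    even-term k l = trans (θ-terms-monomial 1 1 0 1 0 1 (l ℤ.- k) 1 0 0 1 1 1 (ℤ.- k ℤ.- l)) (trans
      (monomial-cong (even-t-exponent k l) (even-Z-exponent k l) (even-B-exponent k l))
      (sym (θ-terms-monomial 2 1 2 2 1 0 k 2 2 1 2 0 1 l)))

    odd-term : ∀ k l →
      θ-term (monomial 1 1 0) (monomial 1 0 1) (k ℤ.- l) * θ-term (monomial 1 0 0) (monomial 1 1 1) (+ 1 ℤ.+ (k ℤ.+ l))
        ≈ t * (θ-term (monomial 4 2 1) (monomial 0 0 1) k * θ-term (monomial 4 1 2) (monomial 0 1 0) l)
    odd-term k l = trans (θ-terms-monomial 1 1 0 1 0 1 (k ℤ.- l) 1 0 0 1 1 1 (+ 1 ℤ.+ (k ℤ.+ l))) (trans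
      (monomial-cong (odd-t-exponent k l) (odd-Z-exponent k l) (odd-B-exponent k l))
      (trans (*-assoc t _ _) (*-congˡ (sym (θ-terms-monomial 4 2 1 0 0 1 k 4 1 2 0 1 0 l)))))

    -- The even and the odd diagonals m + n of the double sum separate the variables.
    θ-sum-* : ∀ {d} N → d ≤ N →
      monomial 1 1 0 ^ d ≈ 0# → monomial 1 0 1 ^ d ≈ 0# → monomial 1 0 0 ^ d ≈ 0# → monomial 1 1 1 ^ d ≈ 0# →
      θ-sum N (monomial 1 1 0) (monomial 1 0 1) * θ-sum N (monomial 1 0 0) (monomial 1 1 1)
        ≈ θ-sum N (monomial 2 1 2) (monomial 2 1 0) * θ-sum N (monomial 2 2 1) (monomial 2 0 1)
          + t * (θ-sum N (monomial 4 2 1) (monomial 0 0 1) * θ-sum N (monomial 4 1 2) (monomial 0 1 0))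
    θ-sum-* {d} N d≤N a₁^d≈0 b₁^d≈0 a₂^d≈0 b₂^d≈0 = begin
      θ-sum N (monomial 1 1 0) (monomial 1 0 1) * θ-sum N (monomial 1 0 0) (monomial 1 1 1)
        ≈⟨ ∑-*-∑ (interval N) (interval N) _ _ ⟩
      ∑ (square N) f
        ≈⟨ ∑-diagonals N f vanishes ⟩
      ∑ (square N) (f ∘ evenDiagonal) + ∑ (square N) (f ∘ oddDiagonal)
        ≈⟨ +-cong (∑-cong (square N) (λ (k , l) → even-term k l)) (∑-cong (square N) (λ (k , l) → odd-term k l)) ⟩
      ∑ (square N) g + ∑ (square N) (λ x → t * h x)
        ≈⟨ +-congˡ (∑-*ˡ (square N) t h) ⟨
      ∑ (square N) g + t * ∑ (square N) h
        ≈⟨ +-cong (∑-*-∑ (interval N) (interval N) _ _) (*-congˡ (∑-*-∑ (interval N) (interval N) _ _)) ⟨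
      _ ∎
      where
      f g h : ℤ × ℤ → Carrier
      f (m , n) = θ-term (monomial 1 1 0) (monomial 1 0 1) m * θ-term (monomial 1 0 0) (monomial 1 1 1) n
      g (k , l) = θ-term (monomial 2 1 2) (monomial 2 1 0) k * θ-term (monomial 2 2 1) (monomial 2 0 1) l
      h (k , l) = θ-term (monomial 4 2 1) (monomial 0 0 1) k * θ-term (monomial 4 1 2) (monomial 0 1 0) l
      vanishes : ∀ m n → N < ℤ.∣ m ∣ ⊎ N < ℤ.∣ n ∣ → f (m , n) ≈ 0#
      vanishes m n (inj₁ N<m) = trans (*-congʳ (θ-term-vanishes {m = m} a₁^d≈0 b₁^d≈0 (ℕ.≤-trans d≤N (ℕ.<⇒≤ N<m)))) (zeroˡ _)
      vanishes m n (inj₂ N<n) = trans (*-congˡ (θ-term-vanishes {m = n} a₂^d≈0 b₂^d≈0 (ℕ.≤-trans d≤N (ℕ.<⇒≤ N<n)))) (zeroʳ _)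

-- The three-term relation

module ThetaIdentity {c ℓ} (R : CommutativeRing c ℓ) where
  open CommutativeRing R hiding (zero)
  open IntegerCoefficients R
  open FiniteSums R
  open ListSums R
  open TripleProduct R
  open ThetaProducts R
  open import Relation.Binary.Reasoning.Setoid setoid
  open import Algebra.Properties.CommutativeSemigroup
    (CommutativeRing.*-commutativeSemigroup R) using () renaming (interchange to *-interchange)

  module _ (q ω : Carrier) (1+ω+ω²≈0 : 1# + ω + ω * ω ≈ 0#) (d : ℕ) (q^d≈0 : q ^ d ≈ 0#) where

    ω³≈1 : ω ^ 3 ≈ 1#
    ω³≈1 = begin
      ω ^ 3                                        ≈⟨ solve 1 (λ ω → ω :^ 3 := :1 :+ (ω :- :1) :* (:1 :+ ω :+ ω :* ω)) refl ω ⟩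
      1# + (ω - 1#) * (1# + ω + ω * ω)             ≈⟨ +-congˡ (trans (*-congˡ 1+ω+ω²≈0) (zeroʳ _)) ⟩
      1# + 0#                                      ≈⟨ solve 0 (:1 :+ con (0 , 0) := :1) refl ⟩
      1#                                           ∎

    -- All theta arguments are such monomials up to sign. Exponents of ω stay natural, with ω² in
    -- the role of ω⁻¹.
    X : ℕ → ℕ → Carrier
    X e k = q ^ e * ω ^ k

    X-* : ∀ e k e′ k′ → X e k * X e′ k′ ≈ X (e ℕ.+ e′) (k ℕ.+ k′)
    X-* e k e′ k′ = trans (*-interchange _ _ _ _) (sym (*-cong (^-homo-* q e e′) (^-homo-* ω k k′)))

    X-^ : ∀ e k n → X e k ^ n ≈ X (e ℕ.* n) (k ℕ.* n)
    X-^ e k n = trans (^-distrib-* _ _ n) (*-cong (^-assocʳ q e n) (^-assocʳ ω k n))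

    X-nilpotent : ∀ e k → (- X (suc e) k) ^ d ≈ 0#
    X-nilpotent e k = trans (^-congˡ d (solve 3 (λ q u v → :- ((q :* u) :* v) := q :* :- (u :* v)) refl q (q ^ e) (ω ^ k)))
      (*-zero-^ {q} {d} _ q^d≈0)

    neg-^-even : ∀ x i → (- x) ^ (i ℕ.+ i) ≈ x ^ (i ℕ.+ i)
    neg-^-even x i = begin
      (- x) ^ (i ℕ.+ i)     ≈⟨ ^-homo-* (- x) i i ⟩
      (- x) ^ i * (- x) ^ i ≈⟨ ^-distrib-* (- x) (- x) i ⟨
      (- x * - x) ^ i       ≈⟨ ^-congˡ i (solve 1 (λ x → :- x :* :- x := x :* x) refl x) ⟩
      (x * x) ^ i           ≈⟨ ^-distrib-* x x i ⟩
      x ^ i * x ^ i         ≈⟨ ^-homo-* x i i ⟨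
      x ^ (i ℕ.+ i)         ∎

    p : Carrier
    p = q ^ 10

    p^d≈0 : p ^ d ≈ 0#
    p^d≈0 = *-zero-^ {q} {d} (q ^ 9) q^d≈0

    module _ (N : ℕ) (2d≤N : d ℕ.+ d ≤ N) where

      -- (ω^k q^e ; q^10)_∞, cut off after N factors.
      G : ℕ → ℕ → Carrier
      G e k = ∏ N (λ i → 1# - X (e ℕ.+ i ℕ.* 10) k)

      J : Carrier
      J = poch p d p^d≈0 (N ℕ.+ N)

      G-∏ : ∀ e k → ∏ N (λ i → 1# + - X e k * p ^ i) ≈ G e k
      G-∏ e k = ∏-cong N λ i → +-congˡ (begin
        - X e k * p ^ i               ≈⟨ solve 3 (λ a b c → :- (a :* b) :* c := :- ((a :* c) :* b)) refl _ _ _ ⟩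
        - ((q ^ e * p ^ i) * ω ^ k)   ≈⟨ -‿cong (*-congʳ (*-congˡ (trans (^-assocʳ q 10 i) (reflexive (≡.cong (q ^_) (ℕ.*-comm 10 i)))))) ⟩
        - ((q ^ e * q ^ (i ℕ.* 10)) * ω ^ k)  ≈⟨ -‿cong (*-congʳ (^-homo-* q e _)) ⟨
        - X (e ℕ.+ i ℕ.* 10) k        ∎)

      module _ (c x z y b w : ℕ) where

        -- The exponents of q and ω in t^i Z^j B^k. The successor `suc c` makes t divisible by q, so
        -- all four theta arguments are nilpotent.
        Eq Eω : ℕ → ℕ → ℕ → ℕ
        Eq i j k = suc c ℕ.* i ℕ.+ (z ℕ.* j ℕ.+ b ℕ.* k)
        Eω i j k = x ℕ.* i ℕ.+ (y ℕ.* j ℕ.+ w ℕ.* k)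

        Y : ℕ → ℕ → ℕ → Carrier
        Y i j k = X (Eq i j k) (Eω i j k)

        private
          t Z B : Carrier
          -- The triple product has factors 1 + a p^i where `G` has 1 - X, hence the sign. After
          -- separation the theta arguments contain only even powers of t, so the sign survives just
          -- in the factor t of the odd part.
          t = - X (suc c) x
          Z = X z y
          B = X b w

        Y-* : ∀ i j k → X (suc c) x ^ i * (Z ^ j * B ^ k) ≈ Y i j k
        Y-* i j k = begin
          X (suc c) x ^ i * (Z ^ j * B ^ k)
            ≈⟨ *-cong (X-^ (suc c) x i) (*-cong (X-^ z y j) (X-^ b w k)) ⟩
          X (suc c ℕ.* i) (x ℕ.* i) * (X (z ℕ.* j) (y ℕ.* j) * X (b ℕ.* k) (w ℕ.* k))
            ≈⟨ *-congˡ (X-* (z ℕ.* j) (y ℕ.* j) (b ℕ.* k) (w ℕ.* k)) ⟩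
          X (suc c ℕ.* i) (x ℕ.* i) * X (z ℕ.* j ℕ.+ b ℕ.* k) (y ℕ.* j ℕ.+ w ℕ.* k)
            ≈⟨ X-* (suc c ℕ.* i) (x ℕ.* i) (z ℕ.* j ℕ.+ b ℕ.* k) (y ℕ.* j ℕ.+ w ℕ.* k) ⟩
          Y i j k ∎

        monomial-even : ∀ i j k → monomial t Z B (i ℕ.+ i) j k ≈ Y (i ℕ.+ i) j k
        monomial-even i j k = trans (*-congʳ (neg-^-even _ i)) (Y-* (i ℕ.+ i) j k)

        monomial-odd : ∀ j k → monomial t Z B 1 j k ≈ - Y 1 j k
        monomial-odd j k = trans (solve 3 (λ x z b → (:- x) :^ 1 :* (z :* b) := :- (x :^ 1 :* (z :* b))) refl _ _ _)
          (-‿cong (Y-* 1 j k))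

        module _ (Eq≡10 : Eq 2 1 1 ≡ 10) (ω^Eω≈1 : ω ^ Eω 2 1 1 ≈ 1#) where

          p-splits : ∀ j k j′ k′ → j ℕ.+ j′ ≡ 1 → k ℕ.+ k′ ≡ 1 → - Y 1 j k * - Y 1 j′ k′ ≈ p
          p-splits j k j′ k′ j+j′≡1 k+k′≡1 = begin
            - Y 1 j k * - Y 1 j′ k′                       ≈⟨ *-cong (monomial-odd j k) (monomial-odd j′ k′) ⟨
            monomial t Z B 1 j k * monomial t Z B 1 j′ k′ ≈⟨ monomial-* t Z B 1 j k 1 j′ k′ ⟩
            monomial t Z B 2 (j ℕ.+ j′) (k ℕ.+ k′)        ≡⟨ ≡.cong₂ (monomial t Z B 2) j+j′≡1 k+k′≡1 ⟩
            monomial t Z B 2 1 1                          ≈⟨ monomial-even 1 1 1 ⟩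
            q ^ Eq 2 1 1 * ω ^ Eω 2 1 1                   ≈⟨ *-cong (reflexive (≡.cong (q ^_) Eq≡10)) ω^Eω≈1 ⟩
            q ^ 10 * 1#                                   ≈⟨ *-identityʳ _ ⟩
            p                                             ∎

          Y-nilpotent : ∀ j k → (- Y 1 j k) ^ d ≈ 0#
          Y-nilpotent j k = X-nilpotent (c ℕ.* 1 ℕ.+ (z ℕ.* j ℕ.+ b ℕ.* k)) (Eω 1 j k)

          pair : ∀ j k j′ k′ → j ℕ.+ j′ ≡ 1 → k ℕ.+ k′ ≡ 1 →
            J * (G (Eq 1 j k) (Eω 1 j k) * G (Eq 1 j′ k′) (Eω 1 j′ k′))
              ≈ θ-sum N (monomial t Z B 1 j k) (monomial t Z B 1 j′ k′)
          pair j k j′ k′ j+j′≡1 k+k′≡1 = begin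
            J * (G (Eq 1 j k) (Eω 1 j k) * G (Eq 1 j′ k′) (Eω 1 j′ k′))
              ≈⟨ *-congˡ (*-cong (G-∏ (Eq 1 j k) (Eω 1 j k)) (G-∏ (Eq 1 j′ k′) (Eω 1 j′ k′))) ⟨
            J * (∏ N (λ i → 1# + - Y 1 j k * p ^ i) * ∏ N (λ i → 1# + - Y 1 j′ k′ * p ^ i))
              ≈⟨ triple-product {d = d} p^d≈0 N (p-splits j k j′ k′ j+j′≡1 k+k′≡1) (Y-nilpotent j k) (Y-nilpotent j′ k′) 2d≤N ⟩
            θ-sum N (- Y 1 j k) (- Y 1 j′ k′)
              ≈⟨ θ-sum-cong N (monomial-odd j k) (monomial-odd j′ k′) ⟨
            θ-sum N (monomial t Z B 1 j k) (monomial t Z B 1 j′ k′) ∎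

          θ-product :
            J * (G (Eq 1 1 0) (Eω 1 1 0) * G (Eq 1 0 1) (Eω 1 0 1)) * (J * (G (Eq 1 0 0) (Eω 1 0 0) * G (Eq 1 1 1) (Eω 1 1 1)))
              ≈ θ-sum N (Y 2 1 2) (Y 2 1 0) * θ-sum N (Y 2 2 1) (Y 2 0 1)
                - X (suc c) x * (θ-sum N (Y 4 2 1) (Y 0 0 1) * θ-sum N (Y 4 1 2) (Y 0 1 0))
          θ-product = begin
            _ ≈⟨ *-cong (pair 1 0 0 1 ≡.refl ≡.refl) (pair 0 0 1 1 ≡.refl ≡.refl) ⟩
            θ-sum N (m 1 1 0) (m 1 0 1) * θ-sum N (m 1 0 0) (m 1 1 1)
              ≈⟨ θ-sum-* t Z B {d} N (ℕ.≤-trans (ℕ.m≤m+n d d) 2d≤N) (nilpotent 1 0) (nilpotent 0 1) (nilpotent 0 0) (nilpotent 1 1) ⟩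
            θ-sum N (m 2 1 2) (m 2 1 0) * θ-sum N (m 2 2 1) (m 2 0 1)
                + t * (θ-sum N (m 4 2 1) (m 0 0 1) * θ-sum N (m 4 1 2) (m 0 1 0))
              ≈⟨ +-cong (*-cong (θ-sum-cong N (monomial-even 1 1 2) (monomial-even 1 1 0))
                                (θ-sum-cong N (monomial-even 1 2 1) (monomial-even 1 0 1)))
                        (trans (*-congˡ (*-cong (θ-sum-cong N (monomial-even 2 2 1) (monomial-even 0 0 1))
                                                (θ-sum-cong N (monomial-even 2 1 2) (monomial-even 0 1 0))))
                               (solve 2 (λ t u → :- t :* u := :- (t :* u)) refl _ _)) ⟩
            _ ∎
            where
            m : ℕ → ℕ → ℕ → Carrier
            m = monomial t Z B
            nilpotent : ∀ j k → monomial t Z B 1 j k ^ d ≈ 0#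
            nilpotent j k = trans (^-congˡ d (monomial-odd j k)) (Y-nilpotent j k)

      -- r_a and s_a for a = 1, 3, 5; σ and ρ (up to a power of ω) are their analogues at ω.
      private
        r₁ r₃ r₅ s₁ s₃ s₅ σ ρ : Carrier
        r₁ = θ-sum N (X 18 0) (X 2 0)
        r₃ = θ-sum N (X 14 0) (X 6 0)
        r₅ = θ-sum N (X 10 0) (X 10 0)
        s₁ = θ-sum N (X 12 0) (X 8 0)
        s₃ = θ-sum N (X 16 0) (X 4 0)
        s₅ = θ-sum N (X 20 0) (X 0 0)
        σ  = θ-sum N (X 10 4) (X 10 2)
        ρ  = θ-sum N (X 20 5) (X 0 1)

        X-ω³ : ∀ e → X e 3 ≈ X e 0
        X-ω³ e = *-congˡ ω³≈1

        X-ω⁶ : ∀ e → X e 6 ≈ X e 0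
        X-ω⁶ e = *-congˡ (trans (^-homo-* ω 3 3) (trans (*-cong ω³≈1 ω³≈1) (*-identityˡ 1#)))

        -- All six instances use t = -x/z, Z = z², B = q^10/x². Then, up to `J` squared, θ(xz)
        -- θ(x/z) = r(x) s(z) - (x/z) s(x) r(z) with r(x) = f(q^20/x², x²) and s(x) = f(q^10 x²,
        -- q^10/x²), where f is Ramanujan's theta function. Here x = q^5 and z = q^3.
        F₅₃ : J * (G 8 0 * G 2 0) * (J * (G 2 0 * G 8 0)) ≈ r₅ * s₃ - X 2 0 * (s₅ * r₃)
        F₅₃ = θ-product 1 0 6 0 0 0 ≡.refl refl

        F₅₁ : J * (G 6 0 * G 4 0) * (J * (G 4 0 * G 6 0)) ≈ r₅ * s₁ - (X 2 0 * X 2 0) * (s₅ * r₁)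
        F₅₁ = trans (θ-product 3 0 2 0 0 0 ≡.refl refl) (+-congˡ (-‿cong (*-congʳ (sym (X-* 2 0 2 0)))))

        F₃₁ : J * (G 4 0 * G 6 0) * (J * (G 2 0 * G 8 0)) ≈ r₃ * s₁ - X 2 0 * (s₃ * r₁)
        F₃₁ = θ-product 1 0 2 0 4 0 ≡.refl refl

        -- Now z = ω², so that xz and x/z are ω² q^a and ω q^a, and x/z supplies the factor `X 1 1`.
        -- Exponents 3 and 6 of ω are reduced to 0 to recover the same r and s as above.
        Fω₁ : J * (G 1 2 * G 9 1) * (J * (G 1 1 * G 9 2)) ≈ r₁ * σ - X 1 1 * (s₁ * ρ)
        Fω₁ = trans (θ-product 0 1 0 1 8 0 ≡.refl ω³≈1) (+-cong (*-congʳ (θ-sum-cong N (X-ω³ 18) (X-ω³ 2)))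
          (-‿cong (*-congˡ (*-congʳ (θ-sum-cong N (X-ω⁶ 12) refl)))))

        Fω₃ : J * (G 3 2 * G 7 1) * (J * (G 3 1 * G 7 2)) ≈ r₃ * σ - (X 1 1 * X 2 0) * (s₃ * ρ)
        Fω₃ = trans (θ-product 2 1 0 1 4 0 ≡.refl ω³≈1) (+-cong (*-congʳ (θ-sum-cong N (X-ω³ 14) (X-ω³ 6)))
          (-‿cong (*-cong (sym (X-* 1 1 2 0)) (*-congʳ (θ-sum-cong N (X-ω⁶ 16) refl)))))

        Fω₅ : J * (G 5 2 * G 5 1) * (J * (G 5 1 * G 5 2)) ≈ r₅ * σ - (X 1 1 * X 2 0 * X 2 0) * (s₅ * ρ)
        Fω₅ = trans (θ-product 4 1 0 1 0 0 ≡.refl ω³≈1) (+-cong (*-congʳ (θ-sum-cong N (X-ω³ 10) (X-ω³ 10)))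
          (-‿cong (*-cong (sym (trans (*-congʳ (X-* 1 1 2 0)) (X-* 3 1 2 0))) (*-congʳ (θ-sum-cong N (X-ω⁶ 20) refl)))))

        -- Here y = q² and x = ω q. With S_a = q^a s_a, the determinant for (a , b) times q^b is the
        -- minor [a b] of the rows r and S, and the relation is [5 1][3 ω] = [5 3][1 ω] +
        -- [3 1][5 ω]. The weights q, q³, q of the three terms leave the factor y in front of the
        -- middle one: this is the source of the shift n - 2.
        plücker : ∀ x y r₁ r₃ r₅ s₁ s₃ s₅ σ ρ →
          (r₅ * s₁ - (y * y) * (s₅ * r₁)) * (r₃ * σ - (x * y) * (s₃ * ρ))
            ≈ y * ((r₅ * s₃ - y * (s₅ * r₃)) * (r₁ * σ - x * (s₁ * ρ)))
            + (r₃ * s₁ - y * (s₃ * r₁)) * (r₅ * σ - (x * y * y) * (s₅ * ρ))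
        plücker = solve 10 (λ x y r₁ r₃ r₅ s₁ s₃ s₅ σ ρ →
          (r₅ :* s₁ :- (y :* y) :* (s₅ :* r₁)) :* (r₃ :* σ :- (x :* y) :* (s₃ :* ρ))
            := y :* ((r₅ :* s₃ :- y :* (s₅ :* r₃)) :* (r₁ :* σ :- x :* (s₁ :* ρ)))
            :+ (r₃ :* s₁ :- y :* (s₃ :* r₁)) :* (r₅ :* σ :- (x :* y :* y) :* (s₅ :* ρ))) refl

      -- With a′ = 10 − a, these are the theta product of q^a to the base q^10, and the product of those
      -- of ω q^a and ω² q^a.
      Θ Ω : ℕ → ℕ → Carrier
      Θ a a′ = G a 0 * G a′ 0
      Ω a a′ = (G a 2 * G a′ 1) * (G a 1 * G a′ 2)

      three-term : (Θ 4 6 * Θ 4 6) * Ω 3 7 ≈ X 2 0 * ((Θ 2 8 * Θ 2 8) * Ω 1 9) + (Θ 2 8 * Θ 4 6) * Ω 5 5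
      -- Each determinant carries `J` twice and each term is a product of two determinants, so the
      -- unit `J` is cancelled four times.
      three-term = unit-cancelˡ (poch-inverse p d p^d≈0 (N ℕ.+ N)) (unit-cancelˡ (poch-inverse p d p^d≈0 (N ℕ.+ N))
        (unit-cancelˡ (poch-inverse p d p^d≈0 (N ℕ.+ N)) (unit-cancelˡ (poch-inverse p d p^d≈0 (N ℕ.+ N)) (begin
          J * (J * (J * (J * ((Θ 4 6 * Θ 4 6) * Ω 3 7))))
            ≈⟨ solve 5 (λ j a b c e → j :* (j :* (j :* (j :* (((a :* b) :* (a :* b)) :* (c :* e)))))
                 := (j :* (b :* a) :* (j :* (a :* b))) :* (j :* c :* (j :* e))) refl J (G 4 0) (G 6 0) _ _ ⟩
          _ ≈⟨ *-cong F₅₁ Fω₃ ⟩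
          _ ≈⟨ plücker (X 1 1) (X 2 0) r₁ r₃ r₅ s₁ s₃ s₅ σ ρ ⟩
          _ ≈⟨ +-cong (*-congˡ (*-cong F₅₃ Fω₁)) (*-cong F₃₁ Fω₅) ⟨
          _ ≈⟨ solve 10 (λ j a b c e f g h k y →
                 y :* ((j :* (b :* a) :* (j :* (a :* b))) :* (j :* f :* (j :* g)))
                   :+ (j :* (c :* e) :* (j :* (a :* b))) :* (j :* h :* (j :* k))
                 := j :* (j :* (j :* (j :* (y :* (((a :* b) :* (a :* b)) :* (f :* g))
                      :+ ((a :* b) :* (c :* e)) :* (h :* k))))))
                 refl J (G 2 0) (G 8 0) (G 4 0) (G 6 0) _ _ _ _ (X 2 0) ⟩
          J * (J * (J * (J * (X 2 0 * ((Θ 2 8 * Θ 2 8) * Ω 1 9) + (Θ 2 8 * Θ 4 6) * Ω 5 5)))) ∎))))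

    -- From base q^10 to base q^30

    1-q^ : ℕ → Carrier
    1-q^ e = 1# - q ^ e

    1-q^-large : ∀ {e} → d ≤ e → 1-q^ e ≈ 1#
    1-q^-large d≤e = trans (+-congˡ (-‿cong (^-zero-mono q^d≈0 d≤e))) (solve 0 (:1 :- con (0 , 0) := :1) refl)

    1-X : ∀ {e e′} → e ≡ e′ → 1# - X e 0 ≈ 1-q^ e′
    1-X ≡.refl = +-congˡ (-‿cong (*-identityʳ _))

    1-X-cube : ∀ e → (1# - X e 0) * ((1# - X e 2) * (1# - X e 1)) ≈ 1-q^ (e ℕ.* 3)
    1-X-cube e = begin
      (1# - X e 0) * ((1# - X e 2) * (1# - X e 1))
        -- The solver treats ω as a free variable, so the discrepancy from 1 - x³ is written as an
        -- explicit multiple of 1 + ω + ω².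
        ≈⟨ solve 2 (λ x ω → (:1 :- x :* ω :^ 0) :* ((:1 :- x :* ω :^ 2) :* (:1 :- x :* ω :^ 1))
             := (:1 :- x :^ 3) :+ (:1 :+ ω :+ ω :* ω) :* (ω :* (x :* x) :- x :+ (:1 :- ω) :* (x :* x :* x))) refl (q ^ e) ω ⟩
      (1# - (q ^ e) ^ 3) + (1# + ω + ω * ω) * _
        ≈⟨ +-cong (+-congˡ (-‿cong (^-assocʳ q e 3))) (trans (*-congʳ 1+ω+ω²≈0) (zeroˡ _)) ⟩
      1-q^ (e ℕ.* 3) + 0#
        ≈⟨ +-identityʳ _ ⟩
      1-q^ (e ℕ.* 3) ∎

    module _ (M : ℕ) (2d≤M : d ℕ.+ d ≤ M) where

      private
        N : ℕ
        -- 3M factors in base q^10 split exactly into three residue classes modulo 30 with M factors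
        -- each.
        N = M ℕ.* 3

        2d≤N : d ℕ.+ d ≤ N
        2d≤N = ℕ.≤-trans 2d≤M (ℕ.m≤m*n M 3)

      B : ℕ → Carrier
      B e = ∏ M (λ i → 1-q^ (e ℕ.+ i ℕ.* 30))

      B⁻¹ : ℕ → Carrier
      B⁻¹ e = ∏ M (λ i → geometric d (q ^ (e ℕ.+ i ℕ.* 30)))

      B-inverse : ∀ e → B (suc e) * B⁻¹ (suc e) ≈ 1#
      B-inverse e = ∏-unit M (λ i → 1-p^i-inverse q d q^d≈0 (e ℕ.+ i ℕ.* 30))

      G-blocks : ∀ e → G N 2d≤N e 0 ≈ B e * B (10 ℕ.+ e) * B (20 ℕ.+ e)
      G-blocks e = begin
        G N 2d≤N e 0
          ≈⟨ ∏-blocks M 3 (λ k → 1# - X (e ℕ.+ k ℕ.* 10) 0) ⟩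
        ∏ M (λ i → 1# * (1# - X (e ℕ.+ (0 ℕ.+ i ℕ.* 3) ℕ.* 10) 0) * (1# - X (e ℕ.+ (1 ℕ.+ i ℕ.* 3) ℕ.* 10) 0)
                   * (1# - X (e ℕ.+ (2 ℕ.+ i ℕ.* 3) ℕ.* 10) 0))
          ≈⟨ ∏-cong M (λ i → *-cong (*-cong (trans (*-identityˡ _) (1-X (exponent₀ e i))) (1-X (exponent₁ e i))) (1-X (exponent₂ e i))) ⟩
        ∏ M (λ i → 1-q^ (e ℕ.+ i ℕ.* 30) * 1-q^ (10 ℕ.+ e ℕ.+ i ℕ.* 30) * 1-q^ (20 ℕ.+ e ℕ.+ i ℕ.* 30))
          ≈⟨ trans (∏-* M _ _) (*-congʳ (∏-* M _ _)) ⟩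
        B e * B (10 ℕ.+ e) * B (20 ℕ.+ e) ∎
        where
        exponent₀ : ∀ e i → e ℕ.+ (0 ℕ.+ i ℕ.* 3) ℕ.* 10 ≡ e ℕ.+ i ℕ.* 30
        exponent₀ = ℕ-Solver.solve-∀
        exponent₁ : ∀ e i → e ℕ.+ (1 ℕ.+ i ℕ.* 3) ℕ.* 10 ≡ 10 ℕ.+ e ℕ.+ i ℕ.* 30
        exponent₁ = ℕ-Solver.solve-∀
        exponent₂ : ∀ e i → e ℕ.+ (2 ℕ.+ i ℕ.* 3) ℕ.* 10 ≡ 20 ℕ.+ e ℕ.+ i ℕ.* 30
        exponent₂ = ℕ-Solver.solve-∀

      G-cube : ∀ e → G N 2d≤N e 0 * (G N 2d≤N e 2 * G N 2d≤N e 1) ≈ B (e ℕ.* 3)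
      G-cube e = begin
        G N 2d≤N e 0 * (G N 2d≤N e 2 * G N 2d≤N e 1)
          ≈⟨ trans (∏-* N _ _) (*-congˡ (∏-* N _ _)) ⟨
        ∏ N (λ i → (1# - X (e ℕ.+ i ℕ.* 10) 0) * ((1# - X (e ℕ.+ i ℕ.* 10) 2) * (1# - X (e ℕ.+ i ℕ.* 10) 1)))
          ≈⟨ ∏-cong N (λ i → trans (1-X-cube (e ℕ.+ i ℕ.* 10)) (reflexive (≡.cong 1-q^ (triple e i)))) ⟩
        ∏ N (λ i → 1-q^ (e ℕ.* 3 ℕ.+ i ℕ.* 30))
          -- Cubing gives 3M factors in base q^30 instead of M. From index M on the exponents are at
          -- least d and the factors are 1.
          ≈⟨ ∏-stable (ℕ.m≤m*n M 3) (λ i M≤i → 1-q^-large (ℕ.≤-trans (ℕ.m≤m+n d d) (ℕ.≤-trans 2d≤M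
               (ℕ.≤-trans M≤i (ℕ.≤-trans (ℕ.m≤m*n i 30) (ℕ.m≤n+m _ (e ℕ.* 3))))))) ⟩
        B (e ℕ.* 3) ∎
        where
        triple : ∀ e i → (e ℕ.+ i ℕ.* 10) ℕ.* 3 ≡ e ℕ.* 3 ℕ.+ i ℕ.* 30
        triple = ℕ-Solver.solve-∀

      ΘΩ : ∀ a a′ → Θ N 2d≤N a a′ * Ω N 2d≤N a a′ ≈ B (a ℕ.* 3) * B (a′ ℕ.* 3)
      ΘΩ a a′ = trans (solve 6 (λ u v a b c e → (u :* v) :* ((a :* b) :* (c :* e)) := (u :* (a :* c)) :* (v :* (e :* b)))
        refl _ _ _ _ _ _) (*-cong (G-cube a) (G-cube a′))

      -- β a is [a] = (q^a, q^{30-a}; q^30)_∞.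
      β : ℕ → Carrier
      β a = B a * B (30 ℕ.∸ a)

      private
        θ₁ θ₂ θ₃ θ₄ : Carrier
        θ₁ = β 1 * β 9 * β 11
        θ₂ = β 2 * β 8 * β 12
        θ₃ = β 3 * β 7 * β 13
        θ₄ = β 4 * β 6 * β 14

        Θ-blocks : ∀ a a′ → Θ N 2d≤N a a′ ≈ (B a * B (20 ℕ.+ a′)) * (B a′ * B (20 ℕ.+ a)) * (B (10 ℕ.+ a) * B (10 ℕ.+ a′))
        Θ-blocks a a′ = trans (*-cong (G-blocks a) (G-blocks a′))
          (solve 6 (λ a b c e f g → (a :* b :* c) :* (e :* f :* g) := (a :* g) :* (e :* c) :* (b :* f)) refl _ _ _ _ _ _)

        Θ₅-blocks : Θ N 2d≤N 5 5 ≈ (β 5 * β 5) * (B 15 * B 15)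
        Θ₅-blocks = Θ-blocks 5 5

        -- θ₅ Ω₅ = [15], and [15] contains the residue 15 twice because 30 - 15 = 15. It therefore
        -- cancels completely against the factor [15] of θ₅ = [5]² [15].
        Ω₅ : (β 5 * β 5) * Ω N 2d≤N 5 5 ≈ 1#
        Ω₅ = unit-cancelˡ (B-inverse 14) (unit-cancelˡ (B-inverse 14) (begin
          B 15 * (B 15 * ((β 5 * β 5) * Ω N 2d≤N 5 5))
            ≈⟨ solve 3 (λ b s o → b :* (b :* (s :* o)) := (s :* (b :* b)) :* o) refl _ _ _ ⟩
          ((β 5 * β 5) * (B 15 * B 15)) * Ω N 2d≤N 5 5   ≈⟨ *-congʳ Θ₅-blocks ⟨
          Θ N 2d≤N 5 5 * Ω N 2d≤N 5 5                     ≈⟨ ΘΩ 5 5 ⟩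
          B 15 * B 15                                     ≈⟨ *-congˡ (*-identityʳ _) ⟨
          B 15 * (B 15 * 1#)                              ∎))

      -- `three-term` times θ₁ θ₃ [5]²: each Ω_a meets its own cofactor and becomes [9], [3] or 1,
      -- so ω has disappeared.
      base-30 : (θ₄ * θ₄) * θ₁ * (β 9 * (β 5 * β 5))
              ≈ q ^ 2 * ((θ₂ * θ₂) * θ₃ * (β 3 * (β 5 * β 5))) + (θ₂ * θ₄) * (θ₁ * θ₃)
      base-30 = begin
        (θ₄ * θ₄) * θ₁ * (β 9 * s)                      ≈⟨ *-congˡ (*-congʳ (trans (*-congʳ (sym (Θ-blocks 3 7))) (ΘΩ 3 7))) ⟨
        (θ₄ * θ₄) * θ₁ * ((θ₃ * Ω′ 3 7) * s)            ≈⟨ solve 5 (λ a b c e f → (a :* a) :* b :* ((c :* e) :* f)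
                                                             := (b :* c :* f) :* ((a :* a) :* e)) refl _ _ _ _ _ ⟩
        (θ₁ * θ₃ * s) * ((θ₄ * θ₄) * Ω′ 3 7)            ≈⟨ *-congˡ base-30′ ⟩
        (θ₁ * θ₃ * s) * (q ^ 2 * ((θ₂ * θ₂) * Ω′ 1 9) + (θ₂ * θ₄) * Ω′ 5 5)
          ≈⟨ solve 8 (λ a b s q c e f g → (a :* b :* s) :* (q :* ((c :* c) :* e) :+ (c :* f) :* g)
               := q :* ((c :* c) :* b :* ((a :* e) :* s)) :+ ((c :* f) :* (a :* b)) :* (s :* g)) refl _ _ _ _ _ _ _ _ ⟩
        q ^ 2 * ((θ₂ * θ₂) * θ₃ * ((θ₁ * Ω′ 1 9) * s)) + ((θ₂ * θ₄) * (θ₁ * θ₃)) * (s * Ω′ 5 5)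
          ≈⟨ +-cong (*-congˡ (*-congˡ (*-congʳ (trans (*-congʳ (sym (Θ-blocks 1 9))) (ΘΩ 1 9))))) (trans (*-congˡ Ω₅) (*-identityʳ _)) ⟩
        q ^ 2 * ((θ₂ * θ₂) * θ₃ * (β 3 * s)) + (θ₂ * θ₄) * (θ₁ * θ₃) ∎
        where
        s = β 5 * β 5
        Ω′ = Ω N 2d≤N
        base-30′ : (θ₄ * θ₄) * Ω′ 3 7 ≈ q ^ 2 * ((θ₂ * θ₂) * Ω′ 1 9) + (θ₂ * θ₄) * Ω′ 5 5
        base-30′ = begin
          (θ₄ * θ₄) * Ω′ 3 7                                    ≈⟨ *-congʳ (*-cong (Θ-blocks 4 6) (Θ-blocks 4 6)) ⟨
          _                                                     ≈⟨ three-term N 2d≤N ⟩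
          _                                                     ≈⟨ +-cong (*-cong (*-identityʳ _) (*-congʳ (*-cong (Θ-blocks 2 8) (Θ-blocks 2 8))))
                                                                     (*-congʳ (*-cong (Θ-blocks 2 8) (Θ-blocks 4 6))) ⟩
          q ^ 2 * ((θ₂ * θ₂) * Ω′ 1 9) + (θ₂ * θ₄) * Ω′ 5 5     ∎

-- Truncated power series and the Eisenstein integers

module PowerSeries {c ℓ} (C : CommutativeRing c ℓ) where
  open CommutativeRing C hiding (zero)
  open import Relation.Binary.Reasoning.Setoid setoid
  open import Algebra.Properties.CommutativeSemigroup
    (CommutativeRing.+-commutativeSemigroup C) using (x∙yz≈y∙xz; interchange)

  Series : Set c
  Series = ℕ → Carrier

  tail : Series → Series
  tail f n = f (suc n)

  constant : Carrier → Series
  constant x zero    = x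
  constant x (suc n) = 0#

  infixl 7 _⊛_
  _⊛_ : Series → Series → Series
  (f ⊛ g) zero    = f 0 * g 0
  (f ⊛ g) (suc n) = f 0 * g (suc n) + (tail f ⊛ g) n

  -- Coefficient n of a product involves only coefficients up to n. Hence multiplication respects
  -- equality up to a fixed order, and truncation needs no quotient type.
  ⊛-cong : ∀ n {f f′ g g′} → (∀ i → i ≤ n → f i ≈ f′ i) → (∀ i → i ≤ n → g i ≈ g′ i) →
           (f ⊛ g) n ≈ (f′ ⊛ g′) n
  ⊛-cong zero    f≈ g≈ = *-cong (f≈ 0 z≤n) (g≈ 0 z≤n)
  ⊛-cong (suc n) f≈ g≈ = +-cong (*-cong (f≈ 0 z≤n) (g≈ (suc n) ℕ.≤-refl))
    (⊛-cong n (λ i i≤n → f≈ (suc i) (s≤s i≤n)) (λ i i≤n → g≈ i (ℕ.m≤n⇒m≤1+n i≤n)))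

  ⊛-unfoldʳ : ∀ n f g → (f ⊛ g) (suc n) ≈ f (suc n) * g 0 + (f ⊛ tail g) n
  ⊛-unfoldʳ zero    f g = +-comm _ _
  ⊛-unfoldʳ (suc n) f g = trans (+-congˡ (⊛-unfoldʳ n (tail f) g)) (x∙yz≈y∙xz _ _ _)

  ⊛-comm : ∀ n f g → (f ⊛ g) n ≈ (g ⊛ f) n
  ⊛-comm zero    f g = *-comm _ _
  ⊛-comm (suc n) f g = trans (+-cong (*-comm _ _) (⊛-comm n (tail f) g)) (sym (⊛-unfoldʳ n g f))

  ⊛-distribʳ : ∀ n h f g → ((λ i → f i + g i) ⊛ h) n ≈ (f ⊛ h) n + (g ⊛ h) n
  ⊛-distribʳ zero    h f g = distribʳ _ _ _
  ⊛-distribʳ (suc n) h f g = trans (+-cong (distribʳ _ _ _) (⊛-distribʳ n h (tail f) (tail g))) (interchange _ _ _ _)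

  ⊛-scaleˡ : ∀ n x f g → ((λ i → x * f i) ⊛ g) n ≈ x * (f ⊛ g) n
  ⊛-scaleˡ zero    x f g = *-assoc _ _ _
  ⊛-scaleˡ (suc n) x f g = trans (+-cong (*-assoc _ _ _) (⊛-scaleˡ n x (tail f) g)) (sym (distribˡ _ _ _))

  ⊛-assoc : ∀ n f g h → ((f ⊛ g) ⊛ h) n ≈ (f ⊛ (g ⊛ h)) n
  ⊛-assoc zero    f g h = *-assoc _ _ _
  ⊛-assoc (suc n) f g h = begin
    f 0 * g 0 * h (suc n) + ((λ i → f 0 * g (suc i) + (tail f ⊛ g) i) ⊛ h) n
      ≈⟨ +-cong (*-assoc _ _ _) (trans (⊛-distribʳ n h _ _) (+-cong (⊛-scaleˡ n _ _ h) (⊛-assoc n (tail f) g h))) ⟩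
    f 0 * (g 0 * h (suc n)) + (f 0 * (tail g ⊛ h) n + (tail f ⊛ (g ⊛ h)) n)
      ≈⟨ +-assoc _ _ _ ⟨
    f 0 * (g 0 * h (suc n)) + f 0 * (tail g ⊛ h) n + (tail f ⊛ (g ⊛ h)) n
      ≈⟨ +-congʳ (distribˡ _ _ _) ⟨
    f 0 * (g 0 * h (suc n) + (tail g ⊛ h) n) + (tail f ⊛ (g ⊛ h)) n ∎

  ⊛-zeroˡ : ∀ n f → ((λ _ → 0#) ⊛ f) n ≈ 0#
  ⊛-zeroˡ zero    f = zeroˡ _
  ⊛-zeroˡ (suc n) f = trans (+-cong (zeroˡ _) (⊛-zeroˡ n f)) (+-identityˡ _)

  constant-⊛ : ∀ n x f → (constant x ⊛ f) n ≈ x * f n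
  constant-⊛ zero    x f = refl
  constant-⊛ (suc n) x f = trans (+-congˡ (⊛-zeroˡ n f)) (+-identityʳ _)

  ⊛-identityˡ : ∀ n f → (constant 1# ⊛ f) n ≈ f n
  ⊛-identityˡ n f = trans (constant-⊛ n 1# f) (*-identityˡ _)

  -- C[[q]] modulo q^(n+1).
  truncatedRing : ℕ → CommutativeRing c ℓ
  truncatedRing n = record
    { Carrier = Series
    ; _≈_ = λ f g → ∀ i → i ≤ n → f i ≈ g i
    ; _+_ = λ f g i → f i + g i
    ; _*_ = _⊛_
    ; -_  = λ f i → - f i
    ; 0#  = λ _ → 0#
    ; 1#  = constant 1#
    ; isCommutativeRing = record
      { isRing = record
        { +-isAbelianGroup = record
          { isGroup = record
            { isMonoid = record
              { isSemigroup = record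
                { isMagma = record
                  { isEquivalence = record
                    { refl  = λ _ _ → refl
                    ; sym   = λ f≈g i i≤n → sym (f≈g i i≤n)
                    ; trans = λ f≈g g≈h i i≤n → trans (f≈g i i≤n) (g≈h i i≤n)
                    }
                  ; ∙-cong = λ f≈ g≈ i i≤n → +-cong (f≈ i i≤n) (g≈ i i≤n)
                  }
                ; assoc = λ f g h i _ → +-assoc _ _ _
                }
              ; identity = (λ f i _ → +-identityˡ _) , (λ f i _ → +-identityʳ _)
              }
            ; inverse = (λ f i _ → -‿inverseˡ _) , (λ f i _ → -‿inverseʳ _)
            ; ⁻¹-cong = λ f≈ i i≤n → -‿cong (f≈ i i≤n)
            }
          ; comm = λ f g i _ → +-comm _ _
          }
        ; *-cong = λ f≈ g≈ i i≤n → ⊛-cong i (λ j j≤i → f≈ j (ℕ.≤-trans j≤i i≤n)) (λ j j≤i → g≈ j (ℕ.≤-trans j≤i i≤n))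
        ; *-assoc = λ f g h i _ → ⊛-assoc i f g h
        ; *-identity = (λ f i _ → ⊛-identityˡ i f) , (λ f i _ → trans (⊛-comm i f _) (⊛-identityˡ i f))
        ; distrib = (λ f g h i _ → trans (⊛-comm i f _) (trans (⊛-distribʳ i f g h) (+-cong (⊛-comm i g f) (⊛-comm i h f))))
                  , (λ h f g i _ → ⊛-distribʳ i h f g)
        }
      ; *-comm = λ f g i _ → ⊛-comm i f g
      }
    }

  indeterminate : Series
  indeterminate zero    = 0#
  indeterminate (suc n) = constant 1# n

  indeterminate-⊛-zero : ∀ f → (indeterminate ⊛ f) 0 ≈ 0#
  indeterminate-⊛-zero f = zeroˡ _

  indeterminate-⊛-suc : ∀ f n → (indeterminate ⊛ f) (suc n) ≈ f n
  indeterminate-⊛-suc f n = trans (+-cong (zeroˡ _) (⊛-identityˡ n f)) (+-identityˡ _)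

-- The pair (a , b) stands for a + b ω.
eisensteinRing : CommutativeRing _ _
eisensteinRing = record
  { Carrier = ℤ × ℤ
  ; _≈_ = _≡_
  ; _+_ = λ (a , b) (c , d) → a ℤ.+ c , b ℤ.+ d
  ; _*_ = λ (a , b) (c , d) → a ℤ.* c ℤ.- b ℤ.* d , a ℤ.* d ℤ.+ b ℤ.* c ℤ.- b ℤ.* d
  ; -_  = λ (a , b) → ℤ.- a , ℤ.- b
  ; 0#  = + 0 , + 0
  ; 1#  = + 1 , + 0
  ; isCommutativeRing = record
    { isRing = record
      { +-isAbelianGroup = record
        { isGroup = record
          { isMonoid = record
            { isSemigroup = record
              { isMagma = record { isEquivalence = ≡.isEquivalence ; ∙-cong = ≡.cong₂ _ }
              ; assoc = λ (a , b) (c , d) (e , f) → ≡.cong₂ _,_ (ℤ.+-assoc a c e) (ℤ.+-assoc b d f)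
              }
            ; identity = (λ (a , b) → ≡.cong₂ _,_ (ℤ.+-identityˡ a) (ℤ.+-identityˡ b))
                       , (λ (a , b) → ≡.cong₂ _,_ (ℤ.+-identityʳ a) (ℤ.+-identityʳ b))
            }
          ; inverse = (λ (a , b) → ≡.cong₂ _,_ (ℤ.+-inverseˡ a) (ℤ.+-inverseˡ b))
                    , (λ (a , b) → ≡.cong₂ _,_ (ℤ.+-inverseʳ a) (ℤ.+-inverseʳ b))
          ; ⁻¹-cong = ≡.cong (λ (a , b) → ℤ.- a , ℤ.- b)
          }
        ; comm = λ (a , b) (c , d) → ≡.cong₂ _,_ (ℤ.+-comm a c) (ℤ.+-comm b d)
        }
      ; *-cong = ≡.cong₂ _
      ; *-assoc = λ (a , b) (c , d) (e , f) → ≡.cong₂ _,_ (assoc₁ a b c d e f) (assoc₂ a b c d e f)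
      ; *-identity = (λ (a , b) → ≡.cong₂ _,_ (identityˡ₁ a b) (identityˡ₂ a b))
                   , (λ (a , b) → ≡.cong₂ _,_ (identityʳ₁ a b) (identityʳ₂ a b))
      ; distrib = (λ (a , b) (c , d) (e , f) → ≡.cong₂ _,_ (distribˡ₁ a b c d e f) (distribˡ₂ a b c d e f))
                , (λ (a , b) (c , d) (e , f) → ≡.cong₂ _,_ (distribʳ₁ a b c d e f) (distribʳ₂ a b c d e f))
      }
    ; *-comm = λ (a , b) (c , d) → ≡.cong₂ _,_ (comm₁ a b c d) (comm₂ a b c d)
    }
  }
  where
  open import Data.Integer.Base using (_+_; _*_; _-_)
  assoc₁ : ∀ a b c d e f → (a * c - b * d) * e - (a * d + b * c - b * d) * f
                         ≡ a * (c * e - d * f) - b * (c * f + d * e - d * f)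
  assoc₁ = ℤ-Solver.solve-∀
  assoc₂ : ∀ a b c d e f →
    (a * c - b * d) * f + (a * d + b * c - b * d) * e - (a * d + b * c - b * d) * f
      ≡ a * (c * f + d * e - d * f) + b * (c * e - d * f) - b * (c * f + d * e - d * f)
  assoc₂ = ℤ-Solver.solve-∀
  identityˡ₁ : ∀ a b → + 1 * a - + 0 * b ≡ a
  identityˡ₁ = ℤ-Solver.solve-∀
  identityˡ₂ : ∀ a b → + 1 * b + + 0 * a - + 0 * b ≡ b
  identityˡ₂ = ℤ-Solver.solve-∀
  identityʳ₁ : ∀ a b → a * + 1 - b * + 0 ≡ a
  identityʳ₁ = ℤ-Solver.solve-∀
  identityʳ₂ : ∀ a b → a * + 0 + b * + 1 - b * + 0 ≡ b
  identityʳ₂ = ℤ-Solver.solve-∀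
  distribˡ₁ : ∀ a b c d e f → a * (c + e) - b * (d + f) ≡ (a * c - b * d) + (a * e - b * f)
  distribˡ₁ = ℤ-Solver.solve-∀
  distribˡ₂ : ∀ a b c d e f → a * (d + f) + b * (c + e) - b * (d + f)
                            ≡ (a * d + b * c - b * d) + (a * f + b * e - b * f)
  distribˡ₂ = ℤ-Solver.solve-∀
  distribʳ₁ : ∀ a b c d e f → (c + e) * a - (d + f) * b ≡ (c * a - d * b) + (e * a - f * b)
  distribʳ₁ = ℤ-Solver.solve-∀
  distribʳ₂ : ∀ a b c d e f → (c + e) * b + (d + f) * a - (d + f) * b
                            ≡ (c * b + d * a - d * b) + (e * b + f * a - f * b)
  distribʳ₂ = ℤ-Solver.solve-∀
  comm₁ : ∀ a b c d → a * c - b * d ≡ c * a - d * b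
  comm₁ = ℤ-Solver.solve-∀
  comm₂ : ∀ a b c d → a * d + b * c - b * d ≡ c * b + d * a - d * b
  comm₂ = ℤ-Solver.solve-∀

-- Generating functions of coloured partitions

private
  multiplicityTerm : ℕ → List ℕ → ℕ → ℕ → ℕ
  multiplicityTerm k ks n j = if does (j ℕ.* k ℕ.≤? n) then countKinds ks (n ∸ j ℕ.* k) else 0

  term-small : ∀ k ks n j → j ℕ.* k ≤ n → multiplicityTerm k ks n j ≡ countKinds ks (n ∸ j ℕ.* k)
  term-small k ks n j jk≤n rewrite dec-true (j ℕ.* k ℕ.≤? n) jk≤n = ≡.refl

  term-large : ∀ k ks n j → n < j ℕ.* k → multiplicityTerm k ks n j ≡ 0
  term-large k ks n j n<jk rewrite dec-false (j ℕ.* k ℕ.≤? n) (ℕ.<⇒≱ n<jk) = ≡.refl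

sum-applyUpTo-cong : ∀ n {f g} → (∀ i → f i ≡ g i) → sum (applyUpTo f n) ≡ sum (applyUpTo g n)
sum-applyUpTo-cong zero    f≡g = ≡.refl
sum-applyUpTo-cong (suc n) f≡g = ≡.cong₂ ℕ._+_ (f≡g 0) (sum-applyUpTo-cong n (f≡g ∘ suc))

sum-applyUpTo-zero : ∀ n {f} → (∀ i → f i ≡ 0) → sum (applyUpTo f n) ≡ 0
sum-applyUpTo-zero zero    f≡0 = ≡.refl
sum-applyUpTo-zero (suc n) f≡0 = ≡.cong₂ ℕ._+_ (f≡0 0) (sum-applyUpTo-zero n (f≡0 ∘ suc))

sum-applyUpTo-stable : ∀ {m n} f → m ≤ n → (∀ i → m ≤ i → f i ≡ 0) → sum (applyUpTo f n) ≡ sum (applyUpTo f m)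
sum-applyUpTo-stable {n = n} f z≤n       f≡0 = sum-applyUpTo-zero n (λ i → f≡0 i z≤n)
sum-applyUpTo-stable f (s≤s m≤n) f≡0 = ≡.cong (f 0 ℕ.+_) (sum-applyUpTo-stable (f ∘ suc) m≤n (λ i m≤i → f≡0 (suc i) (s≤s m≤i)))

countKinds-unfold : ∀ k ks n → countKinds (k ∷ ks) n ≡ sum (applyUpTo (multiplicityTerm k ks n) (suc n))
countKinds-unfold k ks n = ≡.cong sum (map-applyUpTo id (multiplicityTerm k ks n) (suc n))

countKinds-< : ∀ {k n} ks → n < k → countKinds (k ∷ ks) n ≡ countKinds ks n
countKinds-< {k} {n} ks n<k = begin
  countKinds (k ∷ ks) n                                                       ≡⟨ countKinds-unfold k ks n ⟩
  countKinds ks n ℕ.+ sum (applyUpTo (multiplicityTerm k ks n ∘ suc) n)       ≡⟨ ≡.cong (countKinds ks n ℕ.+_)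
    (sum-applyUpTo-zero n (λ j → term-large k ks n (suc j) (ℕ.≤-trans n<k (ℕ.m≤m+n k _)))) ⟩
  countKinds ks n ℕ.+ 0                                                       ≡⟨ ℕ.+-identityʳ _ ⟩
  countKinds ks n                                                             ∎
  where open ≡.≡-Reasoning

-- The first kind is either absent (j = 0) or used at least once, and then one copy can be removed.
-- On generating functions this becomes multiplication by 1 - q^k⁺.
countKinds-+ : ∀ k ks n → let k⁺ = suc k in
  countKinds (k⁺ ∷ ks) (k⁺ ℕ.+ n) ≡ countKinds ks (k⁺ ℕ.+ n) ℕ.+ countKinds (k⁺ ∷ ks) n
countKinds-+ k ks n = begin
  countKinds (k⁺ ∷ ks) (k⁺ ℕ.+ n)
    ≡⟨ countKinds-unfold k⁺ ks (k⁺ ℕ.+ n) ⟩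
  countKinds ks (k⁺ ℕ.+ n) ℕ.+ sum (applyUpTo (multiplicityTerm k⁺ ks (k⁺ ℕ.+ n) ∘ suc) (k⁺ ℕ.+ n))
    ≡⟨ ≡.cong (countKinds ks (k⁺ ℕ.+ n) ℕ.+_) (≡.trans (sum-applyUpTo-cong (k⁺ ℕ.+ n) shift)
         -- The shifted sum has k⁺ + n terms but the count for n only `suc n`; the surplus terms
         -- have j k⁺ > n.
         (≡.trans (sum-applyUpTo-stable (multiplicityTerm k⁺ ks n) (s≤s (ℕ.m≤n+m n k))
           (λ j n<j → term-large k⁺ ks n j (ℕ.≤-trans n<j (ℕ.m≤m*n j k⁺)))) (≡.sym (countKinds-unfold k⁺ ks n)))) ⟩
  countKinds ks (k⁺ ℕ.+ n) ℕ.+ countKinds (k⁺ ∷ ks) n ∎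
  where
  open ≡.≡-Reasoning
  k⁺ = suc k
  shift : ∀ j → multiplicityTerm k⁺ ks (k⁺ ℕ.+ n) (suc j) ≡ multiplicityTerm k⁺ ks n j
  shift j with ℕ.≤-<-connex (j ℕ.* k⁺) n
  ... | inj₁ jk≤n = ≡.trans (term-small k⁺ ks (k⁺ ℕ.+ n) (suc j) (ℕ.+-monoʳ-≤ k⁺ jk≤n))
    (≡.trans (≡.cong (countKinds ks) (ℕ.[m+n]∸[m+o]≡n∸o k⁺ n (j ℕ.* k⁺))) (≡.sym (term-small k⁺ ks n j jk≤n)))
  ... | inj₂ n<jk = ≡.trans (term-large k⁺ ks (k⁺ ℕ.+ n) (suc j) (ℕ.+-monoʳ-< k⁺ n<jk)) (≡.sym (term-large k⁺ ks n j n<jk))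

countKinds-large : ∀ xs {ys n} → All (n <_) ys → countKinds (xs ++ ys) n ≡ countKinds xs n
countKinds-large [] []             = ≡.refl
countKinds-large [] {y ∷ ys} (n<y ∷ n<ys) = ≡.trans (countKinds-< ys n<y) (countKinds-large [] n<ys)
countKinds-large (x ∷ xs) {ys} {n} n<ys = ≡.cong sum (map-cong (λ j →
  ≡.cong (λ y → if does (j ℕ.* x ℕ.≤? n) then y else 0)
    (countKinds-large xs (All.map (ℕ.≤-<-trans (ℕ.m∸n≤m n (j ℕ.* x))) n<ys))) (upTo (suc n)))

kinds : (ℕ → ℕ) → ℕ → List ℕ
kinds colors n = concatMap (λ s → replicate (colors s) s) (map suc (upTo n))

kinds-suc : ∀ colors n → kinds colors (suc n) ≡ kinds colors n ++ replicate (colors (suc n)) (suc n)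
kinds-suc colors n = begin
  concatMap h (map suc (upTo (suc n)))                     ≡⟨ ≡.cong (concatMap h ∘ map suc) (upTo-∷ʳ n) ⟨
  concatMap h (map suc (upTo n ++ [ n ]))                  ≡⟨ ≡.cong (concatMap h) (map-++ suc (upTo n) [ n ]) ⟩
  concatMap h (map suc (upTo n) ++ [ suc n ])              ≡⟨ concatMap-++ h (map suc (upTo n)) [ suc n ] ⟩
  kinds colors n ++ (h (suc n) ++ [])                      ≡⟨ ≡.cong (kinds colors n ++_) (++-identityʳ _) ⟩
  kinds colors n ++ h (suc n)                              ∎
  where
  open ≡.≡-Reasoning
  h = λ s → replicate (colors s) s

-- The list of kinds in `coloredPartitions` grows with its argument, whereas a generating function
-- needs one list for all coefficients. Kinds larger than m cannot occur in a partition of m, so a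
-- long enough list serves them all.
countKinds-kinds : ∀ colors {m n} → m ≤ n → countKinds (kinds colors n) m ≡ coloredPartitions colors m
countKinds-kinds colors {m} {n} m≤n = ≡.trans
  (≡.cong (λ k → countKinds (kinds colors k) m) (≡.sym (ℕ.m∸n+n≡m m≤n))) (extend (n ∸ m))
  where
  extend : ∀ k → countKinds (kinds colors (k ℕ.+ m)) m ≡ coloredPartitions colors m
  extend zero    = ≡.refl
  extend (suc k) = ≡.trans (≡.cong (λ xs → countKinds xs m) (kinds-suc colors (k ℕ.+ m)))
    (≡.trans (countKinds-large (kinds colors (k ℕ.+ m)) (All.replicate⁺ _ (s≤s (ℕ.m≤n+m m k)))) (extend k))

inPM-periodic : ∀ rs i s → inPM rs (s ℕ.+ i ℕ.* 30) ≡ inPM rs s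
inPM-periodic rs i s = ≡.cong (λ x → any (λ r → (x ≡ᵇ r) ∨ (x ≡ᵇ (30 ∸ r))) rs) ([m+kn]%n≡m%n s i 30)

Periodic : (ℕ → ℕ) → Set
Periodic colors = ∀ i s → colors (s ℕ.+ i ℕ.* 30) ≡ colors s

colors-periodic : ∀ two one →
  Periodic (λ s → if inPM two s then 2 else if inPM one s then 1 else 0)
colors-periodic two one i s = ≡.cong₂ (λ x y → if x then 2 else if y then 1 else 0)
  (inPM-periodic two i s) (inPM-periodic one i s)

colors₄-periodic : Periodic colors₄
colors₄-periodic = colors-periodic (2 ∷ 3 ∷ 8 ∷ 12 ∷ []) (7 ∷ 13 ∷ [])

colors₅-periodic : Periodic colors₅
colors₅-periodic = colors-periodic (4 ∷ 6 ∷ 9 ∷ 14 ∷ []) (1 ∷ 11 ∷ [])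

colors₆-periodic : Periodic colors₆
colors₆-periodic = colors-periodic (5 ∷ []) (2 ∷ 3 ∷ 4 ∷ 6 ∷ 8 ∷ 9 ∷ 12 ∷ 14 ∷ [])

-- Division of the theta relation by the color products

module ColorProducts {c ℓ} (R : CommutativeRing c ℓ) where
  open CommutativeRing R hiding (zero)
  open IntegerCoefficients R
  open FiniteSums R
  open import Relation.Binary.Reasoning.Setoid setoid

  -- In fractions: the first hypothesis divided by X₄ X₅ s is 1/X₄ = y/X₅ + T/(X₄ X₅ s), and the
  -- second makes the last quotient 1/(s X₆). To stay inside the ring, both sides are multiplied by
  -- s P₆, a unit with inverse X₆.
  divide : ∀ {y s T X₄ X₅ X₆ P₄ P₅ P₆} →
    X₅ * s ≈ y * (X₄ * s) + T → T * (s * X₆) ≈ X₄ * (X₅ * s) →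
    X₄ * P₄ ≈ 1# → X₅ * P₅ ≈ 1# → s * X₆ * P₆ ≈ 1# → P₄ ≈ y * P₅ + P₆
  divide {y} {s} {T} {X₄} {X₅} {X₆} {P₄} {P₅} {P₆} relation TX₆ X₄P₄ X₅P₅ X₆P₆ = unit-cancelˡ {s * P₆} {X₆}
    (trans (solve 3 (λ s p x → s :* p :* x := s :* x :* p) refl s P₆ X₆) X₆P₆) (begin
    s * P₆ * P₄
      ≈⟨ *-identityʳ _ ⟨
    s * P₆ * P₄ * 1#
      ≈⟨ *-congˡ X₅P₅ ⟨
    s * P₆ * P₄ * (X₅ * P₅)
      ≈⟨ solve 5 (λ s a b c x → s :* c :* a :* (x :* b) := c :* a :* b :* (x :* s)) refl s P₄ P₅ P₆ X₅ ⟩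
    P₆ * P₄ * P₅ * (X₅ * s)
      ≈⟨ *-congˡ relation ⟩
    P₆ * P₄ * P₅ * (y * (X₄ * s) + T)
      ≈⟨ solve 7 (λ s a b c x y t → c :* a :* b :* (y :* (x :* s) :+ t)
           := s :* c :* (y :* b) :* (x :* a) :+ c :* a :* b :* t :* :1) refl s P₄ P₅ P₆ X₄ y T ⟩
    s * P₆ * (y * P₅) * (X₄ * P₄) + P₆ * P₄ * P₅ * T * 1#
      ≈⟨ +-cong (trans (*-congˡ X₄P₄) (*-identityʳ _)) (*-congˡ (sym X₆P₆)) ⟩
    s * P₆ * (y * P₅) + P₆ * P₄ * P₅ * T * (s * X₆ * P₆)
      ≈⟨ +-congˡ (solve 5 (λ a b c t x → c :* a :* b :* t :* (x :* c) := c :* a :* b :* c :* (t :* x)) refl P₄ P₅ P₆ T (s * X₆)) ⟩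
    s * P₆ * (y * P₅) + P₆ * P₄ * P₅ * P₆ * (T * (s * X₆))
      ≈⟨ +-congˡ (*-congˡ TX₆) ⟩
    s * P₆ * (y * P₅) + P₆ * P₄ * P₅ * P₆ * (X₄ * (X₅ * s))
      ≈⟨ +-congˡ (solve 6 (λ s a b c x y → c :* a :* b :* c :* (x :* (y :* s))
           := s :* c :* c :* ((x :* a) :* (y :* b))) refl s P₄ P₅ P₆ X₄ X₅) ⟩
    s * P₆ * (y * P₅) + s * P₆ * P₆ * ((X₄ * P₄) * (X₅ * P₅))
      ≈⟨ +-congˡ (trans (*-congˡ (trans (*-cong X₄P₄ X₅P₅) (*-identityˡ 1#))) (*-identityʳ _)) ⟩
    s * P₆ * (y * P₅) + s * P₆ * P₆
      ≈⟨ distribˡ _ _ _ ⟨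
    s * P₆ * (y * P₅ + P₆) ∎)

  module _ (B : ℕ → Carrier) where

    private
      β : ℕ → Carrier
      β a = B a * B (30 ∸ a)

    colors₄-product : ∏ 30 (λ j → B (suc j) ^ colors₄ (suc j))
      ≈ β 2 * β 2 * β 8 * β 8 * β 12 * β 12 * β 3 * β 3 * β 7 * β 13
    -- The left side spells out `∏ 30`: a leading `:1` for the empty product, then one factor per
    -- residue 1 to 30, with `:1` where there is no color. The right side pairs each residue a with
    -- 30 - a.
    colors₄-product = solve 12 (λ b2 b3 b7 b8 b12 b13 b17 b18 b22 b23 b27 b28 →
      :1 :* :1 :* (b2 :^ 2) :* (b3 :^ 2) :* :1 :* :1 :* :1 :* (b7 :^ 1) :* (b8 :^ 2) :* :1 :* :1
        :* :1 :* (b12 :^ 2) :* (b13 :^ 1) :* :1 :* :1 :* :1 :* (b17 :^ 1) :* (b18 :^ 2) :* :1 :* :1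
        :* :1 :* (b22 :^ 2) :* (b23 :^ 1) :* :1 :* :1 :* :1 :* (b27 :^ 2) :* (b28 :^ 2) :* :1 :* :1
      := (b2 :* b28) :* (b2 :* b28) :* (b8 :* b22) :* (b8 :* b22) :* (b12 :* b18) :* (b12 :* b18)
         :* (b3 :* b27) :* (b3 :* b27) :* (b7 :* b23) :* (b13 :* b17)) refl
      (B 2) (B 3) (B 7) (B 8) (B 12) (B 13) (B 17) (B 18) (B 22) (B 23) (B 27) (B 28)

    colors₅-product : ∏ 30 (λ j → B (suc j) ^ colors₅ (suc j))
      ≈ β 4 * β 4 * β 6 * β 6 * β 14 * β 14 * β 1 * β 9 * β 9 * β 11
    colors₅-product = solve 12 (λ b1 b4 b6 b9 b11 b14 b16 b19 b21 b24 b26 b29 →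
      :1 :* (b1 :^ 1) :* :1 :* :1 :* (b4 :^ 2) :* :1 :* (b6 :^ 2) :* :1 :* :1 :* (b9 :^ 2) :* :1
        :* (b11 :^ 1) :* :1 :* :1 :* (b14 :^ 2) :* :1 :* (b16 :^ 2) :* :1 :* :1 :* (b19 :^ 1) :* :1
        :* (b21 :^ 2) :* :1 :* :1 :* (b24 :^ 2) :* :1 :* (b26 :^ 2) :* :1 :* :1 :* (b29 :^ 1) :* :1
      := (b4 :* b26) :* (b4 :* b26) :* (b6 :* b24) :* (b6 :* b24) :* (b14 :* b16) :* (b14 :* b16)
         :* (b1 :* b29) :* (b9 :* b21) :* (b9 :* b21) :* (b11 :* b19)) refl
      (B 1) (B 4) (B 6) (B 9) (B 11) (B 14) (B 16) (B 19) (B 21) (B 24) (B 26) (B 29)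

    colors₆-product : ∏ 30 (λ j → B (suc j) ^ colors₆ (suc j))
      ≈ β 5 * β 5 * β 2 * β 3 * β 4 * β 6 * β 8 * β 9 * β 12 * β 14
    colors₆-product = solve 18 (λ b2 b3 b4 b5 b6 b8 b9 b12 b14 b16 b18 b21 b22 b24 b25 b26 b27 b28 →
      :1 :* :1 :* (b2 :^ 1) :* (b3 :^ 1) :* (b4 :^ 1) :* (b5 :^ 2) :* (b6 :^ 1) :* :1 :* (b8 :^ 1) :* (b9 :^ 1) :* :1
        :* :1 :* (b12 :^ 1) :* :1 :* (b14 :^ 1) :* :1 :* (b16 :^ 1) :* :1 :* (b18 :^ 1) :* :1 :* :1
        :* (b21 :^ 1) :* (b22 :^ 1) :* :1 :* (b24 :^ 1) :* (b25 :^ 2) :* (b26 :^ 1) :* (b27 :^ 1) :* (b28 :^ 1) :* :1 :* :1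
      := (b5 :* b25) :* (b5 :* b25) :* (b2 :* b28) :* (b3 :* b27) :* (b4 :* b26) :* (b6 :* b24)
         :* (b8 :* b22) :* (b9 :* b21) :* (b12 :* b18) :* (b14 :* b16)) refl
      (B 2) (B 3) (B 4) (B 5) (B 6) (B 8) (B 9) (B 12) (B 14) (B 16) (B 18) (B 21) (B 22) (B 24) (B 25) (B 26) (B 27) (B 28)

    module _ {y P₄ P₅ P₆ : Carrier}
      (P₄-inverse : ∏ 30 (λ j → B (suc j) ^ colors₄ (suc j)) * P₄ ≈ 1#)
      (P₅-inverse : ∏ 30 (λ j → B (suc j) ^ colors₅ (suc j)) * P₅ ≈ 1#)
      (P₆-inverse : ∏ 30 (λ j → B (suc j) ^ colors₆ (suc j)) * P₆ ≈ 1#)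
      (theta : ((β 4 * β 6 * β 14) * (β 4 * β 6 * β 14)) * (β 1 * β 9 * β 11) * (β 9 * (β 5 * β 5))
        ≈ y * (((β 2 * β 8 * β 12) * (β 2 * β 8 * β 12)) * (β 3 * β 7 * β 13) * (β 3 * (β 5 * β 5)))
          + ((β 2 * β 8 * β 12) * (β 4 * β 6 * β 14)) * ((β 1 * β 9 * β 11) * (β 3 * β 7 * β 13))) where

      private
        s T₃ : Carrier
        s = β 5 * β 5
        T₃ = ((β 2 * β 8 * β 12) * (β 4 * β 6 * β 14)) * ((β 1 * β 9 * β 11) * (β 3 * β 7 * β 13))

        X₄ X₅ X₆ : Carrier
        X₄ = β 2 * β 2 * β 8 * β 8 * β 12 * β 12 * β 3 * β 3 * β 7 * β 13
        X₅ = β 4 * β 4 * β 6 * β 6 * β 14 * β 14 * β 1 * β 9 * β 9 * β 11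
        X₆ = β 2 * β 3 * β 4 * β 6 * β 8 * β 9 * β 12 * β 14

        X₄-inverse : X₄ * P₄ ≈ 1#
        X₄-inverse = trans (*-congʳ (sym colors₄-product)) P₄-inverse

        X₅-inverse : X₅ * P₅ ≈ 1#
        X₅-inverse = trans (*-congʳ (sym colors₅-product)) P₅-inverse

        X₆-inverse : s * X₆ * P₆ ≈ 1#
        X₆-inverse = trans (*-congʳ (trans (solve 9 (λ a b c d e f g h i →
            a :* a :* (b :* c :* d :* e :* f :* g :* h :* i) := a :* a :* b :* c :* d :* e :* f :* g :* h :* i) refl
            (β 5) (β 2) (β 3) (β 4) (β 6) (β 8) (β 9) (β 12) (β 14))
          (sym colors₆-product))) P₆-inverse

        theta-relation : X₅ * s ≈ y * (X₄ * s) + T₃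
        theta-relation = begin
          X₅ * s
            ≈⟨ solve 7 (λ a b c d e f s → a :* a :* b :* b :* c :* c :* d :* e :* e :* f :* s
                 := ((a :* b :* c) :* (a :* b :* c)) :* (d :* e :* f) :* (e :* s)) refl
                 (β 4) (β 6) (β 14) (β 1) (β 9) (β 11) s ⟩
          _ ≈⟨ theta ⟩
          _ ≈⟨ +-congʳ (*-congˡ (solve 7 (λ a b c d e f s → ((a :* b :* c) :* (a :* b :* c)) :* (d :* e :* f) :* (d :* s)
                 := a :* a :* b :* b :* c :* c :* d :* d :* e :* f :* s) refl
                 (β 2) (β 8) (β 12) (β 3) (β 7) (β 13) s)) ⟩
          y * (X₄ * s) + T₃ ∎

        T₃X₆ : T₃ * (s * X₆) ≈ X₄ * (X₅ * s)
        T₃X₆ = solve 13 (λ a b c d e f g h i j k l s →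
          (((b :* h :* k) :* (d :* e :* l)) :* ((a :* i :* j) :* (c :* f :* g)))
            :* (s :* (b :* c :* d :* e :* h :* i :* k :* l))
          := (b :* b :* h :* h :* k :* k :* c :* c :* f :* g) :* ((d :* d :* e :* e :* l :* l :* a :* i :* i :* j) :* s)) refl
          (β 1) (β 2) (β 3) (β 4) (β 6) (β 7) (β 13) (β 8) (β 9) (β 11) (β 12) (β 14) s

      products-identity : P₄ ≈ y * P₅ + P₆
      products-identity = divide theta-relation T₃X₆ X₄-inverse X₅-inverse X₆-inverse

-- Partition generating functions in ℤ[ω][[q]] modulo q^(n+1)

module PartitionSeries (n : ℕ) where
  open PowerSeries eisensteinRing using (Series; constant; indeterminate; truncatedRing;
    _⊛_; ⊛-assoc; ⊛-identityˡ; constant-⊛; indeterminate-⊛-zero; indeterminate-⊛-suc)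

  R : CommutativeRing _ _
  R = truncatedRing n

  open CommutativeRing R hiding (zero)
  open IntegerCoefficients R
  open FiniteSums R
  open ColorProducts R
  open ThetaIdentity R using (base-30)
  open import Relation.Binary.Reasoning.Setoid setoid

  private
    module E = CommutativeRing eisensteinRing

    q ω : Series
    q = indeterminate
    ω = constant (+ 0 , + 1)

    0ᴱ : ℤ × ℤ
    0ᴱ = + 0 , + 0

  q^-⊛-< : ∀ k f {i} → i < k → (q ^ k ⊛ f) i ≡ 0ᴱ
  q^-⊛-< (suc k) f {zero}  _         = ≡.trans (⊛-assoc 0 q (q ^ k) f) (indeterminate-⊛-zero (q ^ k ⊛ f))
  q^-⊛-< (suc k) f {suc i} (s≤s i<k) = ≡.trans (⊛-assoc (suc i) q (q ^ k) f)
    (≡.trans (indeterminate-⊛-suc (q ^ k ⊛ f) i) (q^-⊛-< k f i<k))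

  q^-⊛-+ : ∀ k f i → (q ^ k ⊛ f) (k ℕ.+ i) ≡ f i
  q^-⊛-+ zero    f i = ⊛-identityˡ i f
  q^-⊛-+ (suc k) f i = ≡.trans (⊛-assoc (suc k ℕ.+ i) q (q ^ k) f)
    (≡.trans (indeterminate-⊛-suc (q ^ k ⊛ f) (k ℕ.+ i)) (q^-⊛-+ k f i))

  q-nilpotent : q ^ suc n ≈ 0#
  q-nilpotent i i≤n = ≡.trans (≡.sym (*-identityʳ (q ^ suc n) i i≤n)) (q^-⊛-< (suc n) 1# (s≤s i≤n))

  1+ω+ω²≈0 : 1# + ω + ω * ω ≈ 0#
  1+ω+ω²≈0 zero    _ = ≡.refl
  1+ω+ω²≈0 (suc i) _ = ≡.cong ((0ᴱ E.+ 0ᴱ) E.+_) (constant-⊛ (suc i) (+ 0 , + 1) ω)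

  series : List ℕ → Series
  series ks i = + countKinds ks i , + 0

  kindProduct : List ℕ → Series
  kindProduct = foldr (λ k x → (1# - q ^ k) * x) 1#

  -- Coefficientwise this is the recurrence `countKinds-+`, or `countKinds-<` below degree k + 1,
  -- where the shifted series contributes 0.
  series-∷ : ∀ k ks → (1# - q ^ suc k) * series (suc k ∷ ks) ≈ series ks
  series-∷ k ks = trans (solve 2 (λ x f → (:1 :- x) :* f := f :- x :* f) refl (q ^ suc k) F) difference
    where
    F = series (suc k ∷ ks)
    difference : F - q ^ suc k * F ≈ series ks
    difference i _ with ℕ.≤-<-connex (suc k) i
    ... | inj₂ i<k = ≡.trans (≡.cong₂ E._-_ (≡.cong (λ x → + x , + 0) (countKinds-< ks i<k)) (q^-⊛-< (suc k) F i<k))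
      (≡.cong (_, + 0) (ℤ.+-identityʳ _))
    ... | inj₁ k<i with ℕ.m≤n⇒∃[o]m+o≡n k<i
    ... | j , ≡.refl = ≡.trans (≡.cong₂ E._-_ (≡.cong (λ x → + x , + 0) (countKinds-+ k ks j)) (q^-⊛-+ (suc k) F j))
      (≡.cong (_, + 0) (cancel (+ countKinds ks (suc k ℕ.+ j)) (+ countKinds (suc k ∷ ks) j)))
      where
      cancel : ∀ x y → x ℤ.+ y ℤ.- y ≡ x
      cancel = ℤ-Solver.solve-∀

  kindProduct-inverse : ∀ {ks} → All (0 <_) ks → kindProduct ks * series ks ≈ 1#
  kindProduct-inverse [] = trans (*-identityˡ (series [])) λ { zero _ → ≡.refl ; (suc i) _ → ≡.refl }
  kindProduct-inverse {suc k ∷ ks} (_ ∷ 0<ks) = begin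
    (1# - q ^ suc k) * kindProduct ks * series (suc k ∷ ks)
      ≈⟨ solve 3 (λ x y z → x :* y :* z := y :* (x :* z)) refl (1# - q ^ suc k) (kindProduct ks) (series (suc k ∷ ks)) ⟩
    kindProduct ks * ((1# - q ^ suc k) * series (suc k ∷ ks))
      ≈⟨ *-congˡ {kindProduct ks} (series-∷ k ks) ⟩
    kindProduct ks * series ks
      ≈⟨ kindProduct-inverse 0<ks ⟩
    1# ∎

  kindProduct-++ : ∀ xs ys → kindProduct (xs ++ ys) ≈ kindProduct xs * kindProduct ys
  kindProduct-++ []       ys = sym (*-identityˡ (kindProduct ys))
  kindProduct-++ (x ∷ xs) ys = trans (*-congˡ {1# - q ^ x} (kindProduct-++ xs ys))
    (sym (*-assoc (1# - q ^ x) (kindProduct xs) (kindProduct ys)))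

  kindProduct-replicate : ∀ k s → kindProduct (replicate k s) ≈ (1# - q ^ s) ^ k
  kindProduct-replicate zero    s = refl {1#}
  kindProduct-replicate (suc k) s = *-congˡ {1# - q ^ s} (kindProduct-replicate k s)

  kindProduct-kinds : ∀ colors m → kindProduct (kinds colors m) ≈ ∏ m (λ s → (1# - q ^ suc s) ^ colors (suc s))
  kindProduct-kinds colors zero    = refl {1#}
  kindProduct-kinds colors (suc m) = begin
    kindProduct (kinds colors (suc m))
      ≡⟨ ≡.cong kindProduct (kinds-suc colors m) ⟩
    kindProduct (kinds colors m ++ replicate (colors (suc m)) (suc m))
      ≈⟨ kindProduct-++ (kinds colors m) (replicate (colors (suc m)) (suc m)) ⟩
    kindProduct (kinds colors m) * kindProduct (replicate (colors (suc m)) (suc m))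
      ≈⟨ *-cong (kindProduct-kinds colors m) (kindProduct-replicate (colors (suc m)) (suc m)) ⟩
    ∏ (suc m) (λ s → (1# - q ^ suc s) ^ colors (suc s)) ∎

  kinds-positive : ∀ colors m → All (0 <_) (kinds colors m)
  kinds-positive colors zero    = []
  kinds-positive colors (suc m) = ≡.subst (All (0 <_)) (≡.sym (kinds-suc colors m))
    (All.++⁺ (kinds-positive colors m) (All.replicate⁺ (colors (suc m)) (s≤s z≤n)))

  -- Twice the nilpotency exponent `suc n` of q, the length that the truncated triple product
  -- requires.
  M : ℕ
  M = suc n ℕ.+ suc n

  B : ℕ → Series
  B e = ∏ M (λ i → 1# - q ^ (e ℕ.+ i ℕ.* 30))

  P : (ℕ → ℕ) → Series
  P colors i = + coloredPartitions colors i , + 0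

  P-series : ∀ colors → series (kinds colors (M ℕ.* 30)) ≈ P colors
  P-series colors i i≤n = ≡.cong (λ x → + x , + 0) (countKinds-kinds colors (ℕ.≤-trans i≤n
    (ℕ.≤-trans (ℕ.n≤1+n n) (ℕ.≤-trans (ℕ.m≤m+n (suc n) (suc n)) (ℕ.m≤m*n M 30)))))

  -- The sizes 1 to 30M are cut into M blocks of 30. By periodicity the number of colors depends
  -- only on the position j in the block, so exchanging the products collects each residue class
  -- into a power of `B (suc j)`.
  generatingFunction : ∀ {colors} → Periodic colors → ∏ 30 (λ j → B (suc j) ^ colors (suc j)) * P colors ≈ 1#
  generatingFunction {colors} periodic = begin
    ∏ 30 (λ j → B (suc j) ^ colors (suc j)) * P colors
      ≈⟨ *-cong (sym product) (sym (P-series colors)) ⟩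
    kindProduct (kinds colors (M ℕ.* 30)) * series (kinds colors (M ℕ.* 30))
      ≈⟨ kindProduct-inverse (kinds-positive colors (M ℕ.* 30)) ⟩
    1# ∎
    where
    factor : ℕ → ℕ → Series
    factor i j = (1# - q ^ (suc j ℕ.+ i ℕ.* 30)) ^ colors (suc j)
    product : kindProduct (kinds colors (M ℕ.* 30)) ≈ ∏ 30 (λ j → B (suc j) ^ colors (suc j))
    product = begin
      kindProduct (kinds colors (M ℕ.* 30))
        ≈⟨ kindProduct-kinds colors (M ℕ.* 30) ⟩
      ∏ (M ℕ.* 30) (λ s → (1# - q ^ suc s) ^ colors (suc s))
        ≈⟨ ∏-blocks M 30 (λ s → (1# - q ^ suc s) ^ colors (suc s)) ⟩
      ∏ M (λ i → ∏ 30 (λ j → (1# - q ^ (suc j ℕ.+ i ℕ.* 30)) ^ colors (suc j ℕ.+ i ℕ.* 30)))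
        ≈⟨ ∏-cong M (λ i → ∏-cong 30 (λ j → reflexive
             (≡.cong ((1# - q ^ (suc j ℕ.+ i ℕ.* 30)) ^_) (periodic i (suc j))))) ⟩
      ∏ M (λ i → ∏ 30 (factor i))
        ≈⟨ ∏-swap M 30 factor ⟩
      ∏ 30 (λ j → ∏ M (λ i → factor i j))
        ≈⟨ ∏-cong 30 (λ j → ∏-^ M (colors (suc j)) (λ i → 1# - q ^ (suc j ℕ.+ i ℕ.* 30))) ⟩
      ∏ 30 (λ j → B (suc j) ^ colors (suc j)) ∎

  series-identity : P colors₄ ≈ q ^ 2 * P colors₅ + P colors₆
  series-identity = products-identity B (generatingFunction {colors₄} colors₄-periodic)
    (generatingFunction {colors₅} colors₅-periodic) (generatingFunction {colors₆} colors₆-periodic)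
    (base-30 q ω 1+ω+ω²≈0 (suc n) q-nilpotent M ℕ.≤-refl)

  coefficient-identity : ∀ m → 2 ℕ.+ m ≤ n → + p₄ (2 ℕ.+ m) ≡ + p₅ m ℤ.+ + p₆ (2 ℕ.+ m)
  coefficient-identity m 2+m≤n = ≡.cong proj₁ (≡.trans (series-identity (2 ℕ.+ m) 2+m≤n)
    (≡.cong (E._+ P colors₆ (2 ℕ.+ m)) (q^-⊛-+ 2 (P colors₅) m)))

open import Data.Integer using (_-_)

theorem7p2 : (n : ℕ) → 1 < n → (+ p₄ n) - (+ p₅ (n ∸ 2)) ≡ + p₆ n
theorem7p2 (suc zero)    (s≤s ())
theorem7p2 (suc (suc m)) _ = ≡.trans
  -- The truncation order is the argument 2 + m itself, so the wanted coefficient is the last one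
  -- that is retained.
  (≡.cong (ℤ._- + p₅ m) (PartitionSeries.coefficient-identity (2 ℕ.+ m) m ℕ.≤-refl))
  (cancel (+ p₅ m) (+ p₆ (2 ℕ.+ m)))
  where
  cancel : ∀ x y → x ℤ.+ y ℤ.- x ≡ y
  cancel = ℤ-Solver.solve-∀
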